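{- Let $a,b$ be positive integers with $ab=n>1$. Let $\rho(a,b)$ denote the number of pairs $(x,y)$ of integers such that $1<x<y$ and $xy\mid ax+by-1$. Then for every real number $\alpha$ with $1\le\alpha\le\sqrt n$, $$\rho(a,b)<\frac1\alpha\sqrt n\,\log n+2\left(1+\frac{0.6}{\alpha}\right)\sqrt n+\frac{(2n-1)\alpha}{2\sqrt n-\alpha}.$$
   Context: $\log$ is the natural logarithm. -}

module Defs where

open import Data.Empty using (⊥-elim)
open import Data.Integer as ℤ using (ℤ; +_; -[1+_]; 1ℤ)
import Data.Integer.Divisibility as ℤ
import Data.Integer.Properties as ℤ
open import Data.List using (List; filter; length; map; upTo; cartesianProduct)
open import Data.List.Membership.Propositional using (_∈_)
open import Data.List.Membership.Propositional.Properties
  using (∈-filter⁺; ∈-filter⁻; ∈-cartesianProduct⁺; ∈-map⁺; ∈-upTo⁺)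
open import Data.List.Relation.Unary.Unique.Propositional using (Unique)
import Data.List.Relation.Unary.Unique.Propositional.Properties as Unique
open import Data.Nat as ℕ using (ℕ; zero; suc; z≤n; s≤s)
import Data.Nat.Divisibility as ℕ
import Data.Nat.Properties as ℕ
open import Data.Nat.Solver using () renaming (module +-*-Solver to ℕ-Solver)
open import Data.Product using (∃-syntax; _×_; _,_; proj₁; proj₂)
open import Data.Rational as ℚ using (ℚ; mkℚ; 0ℚ; 1ℚ; ½; ∣_∣; toℚᵘ; fromℚᵘ)
import Data.Rational.Properties as ℚ
open import Data.Rational.Solver using (module +-*-Solver)
open import Data.Rational.Unnormalised as ℚᵘ using (mkℚᵘ)
import Data.Rational.Unnormalised.Properties as ℚᵘ
open import Data.Sum using (inj₁; inj₂)
open import Relation.Binary.PropositionalEquality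
  using (_≡_; refl; sym; trans; cong; cong₂; subst; subst₂)
open import Relation.Nullary using (yes; no; Dec)
open import Relation.Nullary.Decidable using (_×-dec_)
open import Relation.Unary using (Decidable)

Solution : ℕ → ℕ → ℤ × ℤ → Set
Solution a b (x , y) =
  1ℤ ℤ.< x × x ℤ.< y × (x ℤ.* y) ℤ.∣ ((+ a) ℤ.* x ℤ.+ (+ b) ℤ.* y ℤ.- 1ℤ)

solution? : ∀ a b → Decidable (Solution a b)
solution? a b (x , y) =
  (1ℤ ℤ.<? x) ×-dec (x ℤ.<? y) ×-dec
  (ℤ.∣ x ℤ.* y ∣ ℕ.∣? ℤ.∣ (+ a) ℤ.* x ℤ.+ (+ b) ℤ.* y ℤ.- 1ℤ ∣)

-- If (x , y) is a solution and a, b are positive, then x < a + b and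
-- y < a (a + b), so no solution is lost by searching this box only; see
-- solutions-sound, solutions-complete and solutions-unique.
box : ℕ → ℕ → List (ℤ × ℤ)
box a b = cartesianProduct (map +_ (upTo (a ℕ.+ b)))
                           (map +_ (upTo (a ℕ.* (a ℕ.+ b))))

solutions : ℕ → ℕ → List (ℤ × ℤ)
solutions a b = filter (solution? a b) (box a b)

ρ : ℕ → ℕ → ℕ
ρ a b = length (solutions a b)

solutions-unique : ∀ a b → Unique (solutions a b)
solutions-unique a b = Unique.filter⁺ (solution? a b)
  (Unique.cartesianProduct⁺
    (Unique.map⁺ ℤ.+-injective (Unique.upTo⁺ (a ℕ.+ b)))
    (Unique.map⁺ ℤ.+-injective (Unique.upTo⁺ (a ℕ.* (a ℕ.+ b)))))

solutions-sound : ∀ a b {p} → p ∈ solutions a b → Solution a b p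
solutions-sound a b p∈ = proj₂ (∈-filter⁻ (solution? a b) {xs = box a b} p∈)

module _ (a b x y : ℕ) (1<x : 1 ℕ.< suc x) (x<y : suc x ℕ.< y) where
  open import Data.Nat
  open import Data.Nat.Properties
  open import Data.Nat.Divisibility
  open ≤-Reasoning

  private
    -- M = a x + b y - 1 with a and x replaced by their successors
    M : ℕ
    M = (x + a * suc x) + b * y

    pos : 0 < x + a * suc x
    pos = ≤-trans (s≤s⁻¹ 1<x) (m≤m+n x (a * suc x))

    instance
      M≢0 : NonZero M
      M≢0 = >-nonZero (≤-trans pos (m≤m+n _ _))

      y≢0 : NonZero y
      y≢0 = >-nonZero (≤-trans (s≤s z≤n) x<y)

      pos≢0 : NonZero (x + a * suc x)
      pos≢0 = >-nonZero pos

  x-bound : (suc x * y) ∣ M → suc x < suc a + b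
  x-bound d = *-cancelʳ-< y (suc x) (suc a + b) (begin-strict
    suc x * y                 ≤⟨ ∣⇒≤ d ⟩
    M                         <⟨ n<1+n M ⟩
    suc a * suc x + b * y     ≤⟨ +-monoˡ-≤ (b * y) (*-monoʳ-≤ (suc a) (<⇒≤ x<y)) ⟩
    suc a * y + b * y         ≡⟨ *-distribʳ-+ y (suc a) b ⟨
    (suc a + b) * y           ∎)

  y-bound : (suc x * y) ∣ M → y < suc a * (suc a + b)
  y-bound d = begin-strict
    y                         ≤⟨ ∣⇒≤ y∣ ⟩
    x + a * suc x             <⟨ n<1+n _ ⟩
    suc a * suc x             ≤⟨ *-monoʳ-≤ (suc a) (<⇒≤ (x-bound d)) ⟩
    suc a * (suc a + b)       ∎
    where
    y∣ : y ∣ (x + a * suc x)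
    y∣ = ∣m+n∣m⇒∣n (subst (y ∣_) (+-comm (x + a * suc x) (b * y))
                     (∣-trans (n∣m*n (suc x)) d))
                   (n∣m*n b)

solutions-complete : ∀ a b → 0 ℕ.< a → 0 ℕ.< b →
                     ∀ {p} → Solution a b p → p ∈ solutions a b
solutions-complete (suc a) b _ _ {+ suc x , + y} s@(ℤ.+<+ 1<x , ℤ.+<+ x<y , d) =
  ∈-filter⁺ (solution? (suc a) b)
    (∈-cartesianProduct⁺
      (∈-map⁺ +_ (∈-upTo⁺ (x-bound a b x y 1<x x<y d′)))
      (∈-map⁺ +_ (∈-upTo⁺ (y-bound a b x y 1<x x<y d′)))) s
  where
  d′ : (suc x ℕ.* y) ℕ.∣ ((x ℕ.+ a ℕ.* suc x) ℕ.+ b ℕ.* y)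
  d′ = subst₂ ℕ._∣_
    (ℤ.abs-* (+ suc x) (+ y))
    (cong ℤ.∣_∣ (trans
      (cong (λ t → (+ suc a) ℤ.* (+ suc x) ℤ.+ t ℤ.- 1ℤ) (sym (ℤ.pos-* b y)))
      refl)) d
solutions-complete (suc a) b _ _ {+ zero , _} (ℤ.+<+ () , _)
solutions-complete (suc a) b _ _ {+ suc x , -[1+ _ ]} (_ , () , _)
solutions-complete (suc a) b _ _ { -[1+ _ ] , _} (() , _)

-- Reciprocal with the convention recip 0 = 0.
recip : ℚ → ℚ
recip p with p ℚ.≟ 0ℚ
... | yes _  = 0ℚ
... | no p≢0 = ℚ.1/_ p {{ℚ.≢-nonZero p≢0}}

Σ[_]_ : ℕ → (ℕ → ℚ) → ℚ
Σ[ zero  ] f = 0ℚ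
Σ[ suc l ] f = Σ[ l ] f ℚ.+ f l

module ℚ-lemmas where
  open import Data.Rational
  open import Data.Rational.Properties
  open ≤-Reasoning
  open +-*-Solver

  toℚᵘ-/ : ∀ p d → toℚᵘ (+ p / suc d) ℚᵘ.≃ mkℚᵘ (+ p) d
  toℚᵘ-/ p d = toℚᵘ-fromℚᵘ (mkℚᵘ (+ p) d)

  /-≤ : ∀ p d q e → p ℕ.* suc e ℕ.≤ q ℕ.* suc d → (+ p / suc d) ≤ (+ q / suc e)
  /-≤ p d q e h = toℚᵘ-cancel-≤
    (ℚᵘ.≤-respˡ-≃ (ℚᵘ.≃-sym (toℚᵘ-/ p d)) (ℚᵘ.≤-respʳ-≃ (ℚᵘ.≃-sym (toℚᵘ-/ q e))
      (ℚᵘ.*≤* (subst₂ ℤ._≤_ (ℤ.pos-* p (suc e)) (ℤ.pos-* q (suc d)) (ℤ.+≤+ h)))))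

  /-+ : ∀ p q d → (+ p / suc d) + (+ q / suc d) ≡ + (p ℕ.+ q) / suc d
  /-+ p q d = toℚᵘ-injective (begin′
    toℚᵘ ((+ p / suc d) + (+ q / suc d))              ≈⟨ toℚᵘ-homo-+ (+ p / suc d) (+ q / suc d) ⟩
    toℚᵘ (+ p / suc d) ℚᵘ.+ toℚᵘ (+ q / suc d)        ≈⟨ ℚᵘ.+-cong (toℚᵘ-/ p d) (toℚᵘ-/ q d) ⟩
    mkℚᵘ (+ p) d ℚᵘ.+ mkℚᵘ (+ q) d                    ≈⟨ ℚᵘ.*≡* lem ⟩
    mkℚᵘ (+ (p ℕ.+ q)) d                              ≈⟨ toℚᵘ-/ (p ℕ.+ q) d ⟨
    toℚᵘ (+ (p ℕ.+ q) / suc d)                        ∎′)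
    where
    open ℚᵘ.≃-Reasoning using (step-≈-⟩; step-≈-⟨) renaming (begin_ to begin′_; _∎ to _∎′)
    D = + suc d
    lem : ((+ p) ℤ.* D ℤ.+ (+ q) ℤ.* D) ℤ.* D ≡ (+ (p ℕ.+ q)) ℤ.* (+ (suc d ℕ.* suc d))
    lem = trans (cong (ℤ._* D) (sym (ℤ.*-distribʳ-+ D (+ p) (+ q))))
                (trans (ℤ.*-assoc (+ (p ℕ.+ q)) D D)
                       (cong ((+ (p ℕ.+ q)) ℤ.*_) (sym (ℤ.pos-* (suc d) (suc d)))))

  /-pos : ∀ d → 0ℚ < + 1 / suc d
  /-pos d = positive⁻¹ _ {{normalize-pos 1 (suc d)}}

  archimedean : ∀ {ε} → 0ℚ < ε → ∃[ N ] (+ 1 / suc N) ≤ ε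
  archimedean {mkℚ (+ suc p) d c} _ = d , toℚᵘ-cancel-≤
    (ℚᵘ.≤-respˡ-≃ (ℚᵘ.≃-sym (toℚᵘ-/ 1 d))
      (ℚᵘ.*≤* (ℤ.*-monoʳ-≤-nonNeg (+ suc d) {+ 1} {+ suc p} (ℤ.+≤+ (s≤s z≤n)))))
  archimedean {mkℚ (+ zero) d c} (*<* (ℤ.+<+ ()))
  archimedean {mkℚ -[1+ _ ] d c} (*<* ())

  halves : ∀ ε → ½ * ε + ½ * ε ≡ ε
  halves = solve 1 (λ e → con ½ :* e :+ con ½ :* e := e) refl

  0<½* : ∀ {ε} → 0ℚ < ε → 0ℚ < ½ * ε
  0<½* {ε} 0<ε = positive⁻¹ (½ * ε) {{pos*pos⇒pos ½ ε {{positive 0<ε}}}}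

  0<* : ∀ {p q} → 0ℚ < p → 0ℚ < q → 0ℚ < p * q
  0<* {p} {q} 0<p 0<q = positive⁻¹ (p * q) {{pos*pos⇒pos p {{positive 0<p}} q {{positive 0<q}}}}

  *-mono : ∀ {p q r s} → 0ℚ ≤ p → 0ℚ ≤ s → p ≤ q → r ≤ s → p * r ≤ q * s
  *-mono {p} {q} {r} {s} 0≤p 0≤s p≤q r≤s = ≤-trans
    (*-monoˡ-≤-nonNeg p {{nonNegative 0≤p}} r≤s)
    (*-monoʳ-≤-nonNeg s {{nonNegative 0≤s}} p≤q)

  recip-inverse : ∀ {p} → 0ℚ < p → p * recip p ≡ 1ℚ
  recip-inverse {p} 0<p with p ≟ 0ℚ
  ... | yes refl = ⊥-elim (<-irrefl refl 0<p)
  ... | no p≢0   = *-inverseʳ p {{≢-nonZero p≢0}}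

  recip-pos : ∀ {p} → 0ℚ < p → 0ℚ < recip p
  recip-pos {p} 0<p with p ≟ 0ℚ
  ... | yes refl = ⊥-elim (<-irrefl refl 0<p)
  ... | no p≢0   = positive⁻¹ _ {{1/pos⇒pos p {{positive 0<p}}}}

  p≤p+q : ∀ {p q} → 0ℚ ≤ q → p ≤ p + q
  p≤p+q {p} {q} 0≤q = subst (_≤ p + q) (+-identityʳ p) (+-monoʳ-≤ p 0≤q)

  ∣p-q∣≤ : ∀ p q {ε} → p ≤ q + ε → q ≤ p + ε → ∣ p - q ∣ ≤ ε
  ∣p-q∣≤ p q {ε} h₁ h₂ with ∣p∣≡p∨∣p∣≡-p (p - q)
  ... | inj₁ eq = begin
    ∣ p - q ∣      ≡⟨ eq ⟩
    p - q          ≤⟨ +-monoˡ-≤ (- q) h₁ ⟩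
    q + ε - q      ≡⟨ solve 2 (λ q e → q :+ e :- q := e) refl q ε ⟩
    ε              ∎
  ... | inj₂ eq = begin
    ∣ p - q ∣      ≡⟨ eq ⟩
    - (p - q)      ≡⟨ solve 2 (λ p q → :- (p :- q) := q :- p) refl p q ⟩
    q - p          ≤⟨ +-monoˡ-≤ (- p) h₂ ⟩
    p + ε - p      ≡⟨ solve 2 (λ q e → q :+ e :- q := e) refl p ε ⟩
    ε              ∎

  Σ-mono-lower : ∀ l p d f → (∀ i → i ℕ.< l → (+ p / suc d) ≤ f i) →
                 (+ (l ℕ.* p) / suc d) ≤ Σ[ l ] f
  Σ-mono-lower zero    p d f h = ≤-reflexive (0/n≡0 (suc d))
  Σ-mono-lower (suc l) p d f h = begin
    + (p ℕ.+ l ℕ.* p) / suc d              ≡⟨ cong (λ t → + t / suc d) (ℕ.+-comm p _) ⟩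
    + (l ℕ.* p ℕ.+ p) / suc d              ≡⟨ /-+ (l ℕ.* p) p d ⟨
    + (l ℕ.* p) / suc d + + p / suc d      ≤⟨ +-mono-≤ (Σ-mono-lower l p d f (λ i i<l → h i (ℕ.m<n⇒m<1+n i<l)))
                                                        (h l (ℕ.n<1+n l)) ⟩
    Σ[ l ] f + f l                         ∎

  Σ-mono-upper : ∀ l p d f → (∀ i → i ℕ.< l → f i ≤ (+ p / suc d)) →
                 Σ[ l ] f ≤ (+ (l ℕ.* p) / suc d)
  Σ-mono-upper zero    p d f h = ≤-reflexive (sym (0/n≡0 (suc d)))
  Σ-mono-upper (suc l) p d f h = begin
    Σ[ l ] f + f l                         ≤⟨ +-mono-≤ (Σ-mono-upper l p d f (λ i i<l → h i (ℕ.m<n⇒m<1+n i<l)))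
                                                        (h l (ℕ.n<1+n l)) ⟩
    + (l ℕ.* p) / suc d + + p / suc d      ≡⟨ /-+ (l ℕ.* p) p d ⟩
    + (l ℕ.* p ℕ.+ p) / suc d              ≡⟨ cong (λ t → + t / suc d) (ℕ.+-comm p _) ⟨
    + (p ℕ.+ l ℕ.* p) / suc d              ∎

  Σ-cong : ∀ l {f g} → (∀ i → f i ≡ g i) → Σ[ l ] f ≡ Σ[ l ] g
  Σ-cong zero    h = refl
  Σ-cong (suc l) h = cong₂ _+_ (Σ-cong l h) (h l)

  Σ-split : ∀ l k f → Σ[ l ℕ.+ k ] f ≡ Σ[ l ] f + Σ[ k ] (λ i → f (l ℕ.+ i))
  Σ-split l zero    f = trans (cong (Σ[_] f) (ℕ.+-identityʳ l)) (sym (+-identityʳ _))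
  Σ-split l (suc k) f = trans (cong (Σ[_] f) (ℕ.+-suc l k))
    (trans (cong (_+ f (l ℕ.+ k)) (Σ-split l k f)) (+-assoc (Σ[ l ] f) _ _))

-- Cauchy sequences of rationals, with a modulus of convergence; no quotient is
-- taken, and _<_, _≤_ are insensitive to the choice of representative.
record ℝ : Set where
  no-eta-equality
  field
    seq    : ℕ → ℚ
    cauchy : ∀ {ε} → 0ℚ ℚ.< ε →
             ∃[ N ] (∀ i j → N ℕ.≤ i → N ℕ.≤ j → ∣ seq i ℚ.- seq j ∣ ℚ.≤ ε)
open ℝ public

infix 4 _<_ _≤_

record _<_ (x y : ℝ) : Set where
  constructor mk<
  field
    gap     : ℚ
    gap-pos : 0ℚ ℚ.< gap
    from    : ℕ
    holds   : ∀ i → from ℕ.≤ i → seq x i ℚ.+ gap ℚ.≤ seq y i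

record _≤_ (x y : ℝ) : Set where
  constructor mk≤
  field
    holds : ∀ {ε} → 0ℚ ℚ.< ε → ∃[ N ] (∀ i → N ℕ.≤ i → seq x i ℚ.≤ seq y i ℚ.+ ε)

fromℚ : ℚ → ℝ
fromℚ q .seq _ = q
fromℚ q .cauchy 0<ε = 0 , λ i j _ _ →
  subst (ℚ._≤ _) (sym (cong ∣_∣ (ℚ.+-inverseʳ q))) (ℚ.<⇒≤ 0<ε)

fromℕ : ℕ → ℝ
fromℕ n = fromℚ (+ n ℚ./ 1)

infix  8 -_
infixl 6 _+_ _-_
infixl 7 _*_ _÷_[_]

_+_ : ℝ → ℝ → ℝ
(x + y) .seq i = seq x i ℚ.+ seq y i
(x + y) .cauchy {ε} 0<ε =
  let M , hx = cauchy x (0<½* 0<ε)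
      N , hy = cauchy y (0<½* 0<ε)
  in M ℕ.⊔ N , λ i j hi hj → begin
    ∣ (seq x i ℚ.+ seq y i) ℚ.- (seq x j ℚ.+ seq y j) ∣
      ≡⟨ cong ∣_∣ (solve 4 (λ a b c d → (a :+ b) :- (c :+ d) := (a :- c) :+ (b :- d)) refl
           (seq x i) (seq y i) (seq x j) (seq y j)) ⟩
    ∣ (seq x i ℚ.- seq x j) ℚ.+ (seq y i ℚ.- seq y j) ∣
      ≤⟨ ℚ.∣p+q∣≤∣p∣+∣q∣ (seq x i ℚ.- seq x j) (seq y i ℚ.- seq y j) ⟩
    ∣ seq x i ℚ.- seq x j ∣ ℚ.+ ∣ seq y i ℚ.- seq y j ∣
      ≤⟨ ℚ.+-mono-≤ (hx i j (ℕ.m⊔n≤o⇒m≤o M N hi) (ℕ.m⊔n≤o⇒m≤o M N hj))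
                    (hy i j (ℕ.m⊔n≤o⇒n≤o M N hi) (ℕ.m⊔n≤o⇒n≤o M N hj)) ⟩
    ½ ℚ.* ε ℚ.+ ½ ℚ.* ε
      ≡⟨ halves ε ⟩
    ε ∎
  where
  open ℚ-lemmas
  open ℚ.≤-Reasoning
  open +-*-Solver

-_ : ℝ → ℝ
(- x) .seq i = ℚ.- seq x i
(- x) .cauchy {ε} 0<ε =
  let N , h = cauchy x 0<ε
  in N , λ i j hi hj → subst (ℚ._≤ ε)
       (trans (sym (ℚ.∣-p∣≡∣p∣ (seq x i ℚ.- seq x j)))
              (cong ∣_∣ (solve 2 (λ a b → :- (a :- b) := (:- a) :- (:- b)) refl (seq x i) (seq x j))))
       (h i j hi hj)
  where open +-*-Solver

_-_ : ℝ → ℝ → ℝ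
x - y = x + (- y)

eventually-bounded : ∀ x → ∃[ K ] (0ℚ ℚ.< K × ∃[ N ] (∀ i → N ℕ.≤ i → ∣ seq x i ∣ ℚ.≤ K))
eventually-bounded x =
  let N , h = cauchy x {1ℚ} (ℚ.positive⁻¹ 1ℚ)
  in 1ℚ ℚ.+ ∣ seq x N ∣
   , ℚ.<-≤-trans (ℚ.positive⁻¹ 1ℚ) (p≤p+q (ℚ.0≤∣p∣ (seq x N)))
   , N , λ i hi → begin
    ∣ seq x i ∣
      ≡⟨ cong ∣_∣ (solve 2 (λ a b → a := (a :- b) :+ b) refl (seq x i) (seq x N)) ⟩
    ∣ (seq x i ℚ.- seq x N) ℚ.+ seq x N ∣
      ≤⟨ ℚ.∣p+q∣≤∣p∣+∣q∣ (seq x i ℚ.- seq x N) (seq x N) ⟩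
    ∣ seq x i ℚ.- seq x N ∣ ℚ.+ ∣ seq x N ∣
      ≤⟨ ℚ.+-monoˡ-≤ ∣ seq x N ∣ (h i N hi ℕ.≤-refl) ⟩
    1ℚ ℚ.+ ∣ seq x N ∣ ∎
  where
  open ℚ-lemmas
  open ℚ.≤-Reasoning
  open +-*-Solver

_*_ : ℝ → ℝ → ℝ
(x * y) .seq i = seq x i ℚ.* seq y i
(x * y) .cauchy {ε} 0<ε =
  let K , 0<K , B , bx = eventually-bounded x
      L , 0<L , C , by = eventually-bounded y
      0<η = 0<* (recip-pos 0<K) (0<½* 0<ε)
      0<θ = 0<* (recip-pos 0<L) (0<½* 0<ε)
      M , hx = cauchy x 0<θ
      N , hy = cauchy y 0<η
      T = (B ℕ.⊔ C) ℕ.⊔ (M ℕ.⊔ N)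
      T≥B : ∀ {i} → T ℕ.≤ i → B ℕ.≤ i
      T≥B h = ℕ.m⊔n≤o⇒m≤o B C (ℕ.m⊔n≤o⇒m≤o (B ℕ.⊔ C) (M ℕ.⊔ N) h)
      T≥C : ∀ {i} → T ℕ.≤ i → C ℕ.≤ i
      T≥C h = ℕ.m⊔n≤o⇒n≤o B C (ℕ.m⊔n≤o⇒m≤o (B ℕ.⊔ C) (M ℕ.⊔ N) h)
      T≥M : ∀ {i} → T ℕ.≤ i → M ℕ.≤ i
      T≥M h = ℕ.m⊔n≤o⇒m≤o M N (ℕ.m⊔n≤o⇒n≤o (B ℕ.⊔ C) (M ℕ.⊔ N) h)
      T≥N : ∀ {i} → T ℕ.≤ i → N ℕ.≤ i
      T≥N h = ℕ.m⊔n≤o⇒n≤o M N (ℕ.m⊔n≤o⇒n≤o (B ℕ.⊔ C) (M ℕ.⊔ N) h)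
  in T , λ i j hi hj → begin
    ∣ seq x i ℚ.* seq y i ℚ.- seq x j ℚ.* seq y j ∣
      ≡⟨ cong ∣_∣ (solve 4 (λ a b c d → a :* b :- c :* d := a :* (b :- d) :+ d :* (a :- c)) refl
           (seq x i) (seq y i) (seq x j) (seq y j)) ⟩
    ∣ seq x i ℚ.* (seq y i ℚ.- seq y j) ℚ.+ seq y j ℚ.* (seq x i ℚ.- seq x j) ∣
      ≤⟨ ℚ.∣p+q∣≤∣p∣+∣q∣ (seq x i ℚ.* (seq y i ℚ.- seq y j)) (seq y j ℚ.* (seq x i ℚ.- seq x j)) ⟩
    ∣ seq x i ℚ.* (seq y i ℚ.- seq y j) ∣ ℚ.+ ∣ seq y j ℚ.* (seq x i ℚ.- seq x j) ∣
      ≡⟨ cong₂ ℚ._+_ (ℚ.∣p*q∣≡∣p∣*∣q∣ (seq x i) (seq y i ℚ.- seq y j))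
                     (ℚ.∣p*q∣≡∣p∣*∣q∣ (seq y j) (seq x i ℚ.- seq x j)) ⟩
    ∣ seq x i ∣ ℚ.* ∣ seq y i ℚ.- seq y j ∣ ℚ.+ ∣ seq y j ∣ ℚ.* ∣ seq x i ℚ.- seq x j ∣
      ≤⟨ ℚ.+-mono-≤
           (*-mono (ℚ.0≤∣p∣ (seq x i)) (ℚ.<⇒≤ 0<η) (bx i (T≥B hi)) (hy i j (T≥N hi) (T≥N hj)))
           (*-mono (ℚ.0≤∣p∣ (seq y j)) (ℚ.<⇒≤ 0<θ) (by j (T≥C hj)) (hx i j (T≥M hi) (T≥M hj))) ⟩
    K ℚ.* (recip K ℚ.* (½ ℚ.* ε)) ℚ.+ L ℚ.* (recip L ℚ.* (½ ℚ.* ε))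
      ≡⟨ cong₂ ℚ._+_ (cancel 0<K) (cancel 0<L) ⟩
    ½ ℚ.* ε ℚ.+ ½ ℚ.* ε
      ≡⟨ halves ε ⟩
    ε ∎
  where
  open ℚ-lemmas
  open ℚ.≤-Reasoning
  open +-*-Solver
  cancel : ∀ {K} → 0ℚ ℚ.< K → K ℚ.* (recip K ℚ.* (½ ℚ.* ε)) ≡ ½ ℚ.* ε
  cancel {K} 0<K = trans (sym (ℚ.*-assoc K (recip K) (½ ℚ.* ε)))
    (trans (cong (ℚ._* (½ ℚ.* ε)) (recip-inverse 0<K)) (ℚ.*-identityˡ (½ ℚ.* ε)))

-- The terms are eventually bounded below by gap, so the convention for
-- recip 0 affects only finitely many of them.
reciprocal : (x : ℝ) → fromℕ 0 < x → ℝ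
reciprocal x _ .seq i = recip (seq x i)
reciprocal x (mk< δ 0<δ B h) .cauchy {ε} 0<ε =
  let N , hx = cauchy x (0<* (0<* 0<δ 0<δ) 0<ε)
      T≥B : ∀ {i} → B ℕ.⊔ N ℕ.≤ i → B ℕ.≤ i
      T≥B = ℕ.m⊔n≤o⇒m≤o B N
      T≥N : ∀ {i} → B ℕ.⊔ N ℕ.≤ i → N ℕ.≤ i
      T≥N = ℕ.m⊔n≤o⇒n≤o B N
  in B ℕ.⊔ N , λ i j hi hj →
     bound (seq x i) (seq x j) (lower i (T≥B hi)) (lower j (T≥B hj))
           (hx j i (T≥N hj) (T≥N hi))
  where
  open ℚ-lemmas
  open ℚ.≤-Reasoning
  open +-*-Solver

  lower : ∀ i → B ℕ.≤ i → δ ℚ.≤ seq x i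
  lower i hi = subst (ℚ._≤ seq x i) (ℚ.+-identityˡ δ) (h i hi)

  bound : ∀ p q → δ ℚ.≤ p → δ ℚ.≤ q → ∣ q ℚ.- p ∣ ℚ.≤ δ ℚ.* δ ℚ.* ε →
          ∣ recip p ℚ.- recip q ∣ ℚ.≤ ε
  bound p q δ≤p δ≤q hpq = begin
    ∣ u ℚ.- v ∣
      ≡⟨ cong ∣_∣ diff ⟩
    ∣ u ℚ.* v ℚ.* (q ℚ.- p) ∣
      ≡⟨ ℚ.∣p*q∣≡∣p∣*∣q∣ (u ℚ.* v) (q ℚ.- p) ⟩
    ∣ u ℚ.* v ∣ ℚ.* ∣ q ℚ.- p ∣
      ≡⟨ cong (ℚ._* ∣ q ℚ.- p ∣) (ℚ.0≤p⇒∣p∣≡p (ℚ.<⇒≤ 0<uv)) ⟩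
    u ℚ.* v ℚ.* ∣ q ℚ.- p ∣
      ≤⟨ ℚ.*-monoˡ-≤-nonNeg (u ℚ.* v) {{ℚ.nonNegative (ℚ.<⇒≤ 0<uv)}} hpq ⟩
    u ℚ.* v ℚ.* (δ ℚ.* δ ℚ.* ε)
      ≡⟨ solve 4 (λ u v d e → u :* v :* (d :* d :* e) := (u :* d) :* ((v :* d) :* e)) refl u v δ ε ⟩
    (u ℚ.* δ) ℚ.* ((v ℚ.* δ) ℚ.* ε)
      ≤⟨ *-mono (ℚ.<⇒≤ (0<* 0<u 0<δ)) (ℚ.<⇒≤ (0<* (positive⇒ 1ℚ) 0<ε)) (small δ≤p 0<p)
           (ℚ.*-monoʳ-≤-nonNeg ε {{ℚ.nonNegative (ℚ.<⇒≤ 0<ε)}} (small δ≤q 0<q)) ⟩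
    1ℚ ℚ.* (1ℚ ℚ.* ε)
      ≡⟨ solve 1 (λ e → con 1ℚ :* (con 1ℚ :* e) := e) refl ε ⟩
    ε ∎
    where
    u = recip p
    v = recip q
    positive⇒ : ∀ r .{{_ : ℚ.Positive r}} → 0ℚ ℚ.< r
    positive⇒ r = ℚ.positive⁻¹ r
    0<p = ℚ.<-≤-trans 0<δ δ≤p
    0<q = ℚ.<-≤-trans 0<δ δ≤q
    0<u = recip-pos 0<p
    0<uv = 0<* 0<u (recip-pos 0<q)
    small : ∀ {r} → δ ℚ.≤ r → 0ℚ ℚ.< r → recip r ℚ.* δ ℚ.≤ 1ℚ
    small {r} δ≤r 0<r = begin
      recip r ℚ.* δ
        ≤⟨ ℚ.*-monoˡ-≤-nonNeg (recip r) {{ℚ.nonNegative (ℚ.<⇒≤ (recip-pos 0<r))}} δ≤r ⟩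
      recip r ℚ.* r   ≡⟨ ℚ.*-comm (recip r) r ⟩
      r ℚ.* recip r   ≡⟨ recip-inverse 0<r ⟩
      1ℚ              ∎
    diff : u ℚ.- v ≡ u ℚ.* v ℚ.* (q ℚ.- p)
    diff = sym (begin-equality
      u ℚ.* v ℚ.* (q ℚ.- p)
        ≡⟨ solve 4 (λ u v p q → u :* v :* (q :- p) := u :* (q :* v) :- v :* (p :* u)) refl u v p q ⟩
      u ℚ.* (q ℚ.* v) ℚ.- v ℚ.* (p ℚ.* u)
        ≡⟨ cong₂ (λ s t → u ℚ.* s ℚ.- v ℚ.* t) (recip-inverse 0<q) (recip-inverse 0<p) ⟩
      u ℚ.* 1ℚ ℚ.- v ℚ.* 1ℚ
        ≡⟨ cong₂ ℚ._-_ (ℚ.*-identityʳ u) (ℚ.*-identityʳ v) ⟩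
      u ℚ.- v ∎)

_÷_[_] : (x y : ℝ) → fromℕ 0 < y → ℝ
x ÷ y [ 0<y ] = x * reciprocal y 0<y

fromApproximations : (f : ℕ → ℚ) → (∀ i j → f i ℚ.≤ f j ℚ.+ + 1 ℚ./ suc j) → ℝ
fromApproximations f h .seq = f
fromApproximations f h .cauchy {ε} 0<ε =
  let N , 1/N≤ε = archimedean 0<ε
      le : ∀ i j → N ℕ.≤ j → f i ℚ.≤ f j ℚ.+ ε
      le i j hj = ℚ.≤-trans (h i j) (ℚ.+-monoʳ-≤ (f j) (ℚ.≤-trans
        (/-≤ 1 j 1 N (ℕ.*-monoʳ-≤ 1 (s≤s hj))) 1/N≤ε))
  in N , λ i j hi hj → ∣p-q∣≤ (f i) (f j) (le i j hj) (le j i hi)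
  where open ℚ-lemmas

-- Given r = ⌊ √ (n - 1) ⌋, this is ⌊ √ n ⌋.
isqrt-step : ℕ → ℕ → ℕ
isqrt-step n r with suc r ℕ.* suc r ℕ.≤? n
... | yes _ = suc r
... | no  _ = r

-- ⌊ √ n ⌋
isqrt : ℕ → ℕ
isqrt zero    = 0
isqrt (suc n) = isqrt-step (suc n) (isqrt n)

isqrt-lower : ∀ n → isqrt n ℕ.* isqrt n ℕ.≤ n
isqrt-lower zero    = z≤n
isqrt-lower (suc n) with suc (isqrt n) ℕ.* suc (isqrt n) ℕ.≤? suc n
... | yes h = h
... | no  _ = ℕ.m≤n⇒m≤1+n (isqrt-lower n)

isqrt-upper : ∀ n → n ℕ.< suc (isqrt n) ℕ.* suc (isqrt n)
isqrt-upper zero    = s≤s z≤n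
isqrt-upper (suc n) with suc (isqrt n) ℕ.* suc (isqrt n) ℕ.≤? suc n
... | yes _ = ℕ.≤-<-trans (isqrt-upper n) (ℕ.*-mono-< (ℕ.n<1+n r) (ℕ.n<1+n r))
  where r = suc (isqrt n)
... | no ¬h = ℕ.≰⇒> ¬h

square-cancel-< : ∀ r s → r ℕ.* r ℕ.< s ℕ.* s → r ℕ.< s
square-cancel-< r s h = ℕ.≰⇒> λ s≤r → ℕ.<⇒≱ h (ℕ.*-mono-≤ s≤r s≤r)

√-approximation : ℕ → ℕ → ℚ
√-approximation n k = + isqrt (n ℕ.* (suc k ℕ.* suc k)) ℚ./ suc k

infix 9 √_

-- √ n is the limit of ⌊ √ (n m²) ⌋ / m as m → ∞.
√_ : ℕ → ℝ
√ n = fromApproximations (√-approximation n) close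
  where
  open ℚ-lemmas
  open ℚ.≤-Reasoning

  cross : ∀ i j → isqrt (n ℕ.* (suc i ℕ.* suc i)) ℕ.* suc j ℕ.≤
                  (isqrt (n ℕ.* (suc j ℕ.* suc j)) ℕ.+ 1) ℕ.* suc i
  cross i j = ℕ.<⇒≤ (square-cancel-< _ _ (N.begin-strict
    (r ℕ.* J) ℕ.* (r ℕ.* J)
      N.≡⟨ solve 2 (λ r J → (r :* J) :* (r :* J) := (r :* r) :* (J :* J)) refl r J ⟩
    (r ℕ.* r) ℕ.* (J ℕ.* J)
      N.≤⟨ ℕ.*-monoˡ-≤ (J ℕ.* J) (isqrt-lower (n ℕ.* (I ℕ.* I))) ⟩
    n ℕ.* (I ℕ.* I) ℕ.* (J ℕ.* J)
      N.≡⟨ solve 3 (λ n I J → n :* I :* J := n :* J :* I) refl n (I ℕ.* I) (J ℕ.* J) ⟩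
    n ℕ.* (J ℕ.* J) ℕ.* (I ℕ.* I)
      N.<⟨ ℕ.*-monoˡ-< (I ℕ.* I) (isqrt-upper (n ℕ.* (J ℕ.* J))) ⟩
    suc s ℕ.* suc s ℕ.* (I ℕ.* I)
      N.≡⟨ cong (λ t → t ℕ.* t ℕ.* (I ℕ.* I)) (ℕ.+-comm 1 s) ⟩
    (s ℕ.+ 1) ℕ.* (s ℕ.+ 1) ℕ.* (I ℕ.* I)
      N.≡⟨ solve 2 (λ t I → t :* t :* (I :* I) := (t :* I) :* (t :* I)) refl (s ℕ.+ 1) I ⟩
    ((s ℕ.+ 1) ℕ.* I) ℕ.* ((s ℕ.+ 1) ℕ.* I) N.∎))
    where
    module N = ℕ.≤-Reasoning
    open ℕ-Solver
    I = suc i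
    J = suc j
    r = isqrt (n ℕ.* (I ℕ.* I))
    s = isqrt (n ℕ.* (J ℕ.* J))

  close : ∀ i j → √-approximation n i ℚ.≤ √-approximation n j ℚ.+ + 1 ℚ./ suc j
  close i j = begin
    √-approximation n i
      ≤⟨ /-≤ (isqrt (n ℕ.* (suc i ℕ.* suc i))) i (isqrt (n ℕ.* (suc j ℕ.* suc j)) ℕ.+ 1) j (cross i j) ⟩
    + (isqrt (n ℕ.* (suc j ℕ.* suc j)) ℕ.+ 1) ℚ./ suc j
      ≡⟨ /-+ (isqrt (n ℕ.* (suc j ℕ.* suc j))) 1 j ⟨
    √-approximation n j ℚ.+ + 1 ℚ./ suc j ∎

-- 1/(m+1) + 1/(m+2) + ⋯ + 1/(m+l)
harmonic : ℕ → ℕ → ℚ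
harmonic m l = Σ[ l ] (λ i → + 1 ℚ./ suc (m ℕ.+ i))

-- For n ≥ 1, log n = ∫₁ⁿ dt/t.  The right-endpoint Riemann sum of this
-- integral with mesh 1/m is
--   ∑ (1/m) · 1/(1 + i/m) = ∑ 1/(m + i)    (1 ≤ i ≤ (n - 1) m),
-- and log n is its limit as m → ∞.  The value at n = 0 is a dummy.
log-approximation : ℕ → ℕ → ℚ
log-approximation n k = harmonic (suc k) ((n ℕ.∸ 1) ℕ.* suc k)

module log-lemmas where
  open ℚ-lemmas
  open ℚ.≤-Reasoning
  open +-*-Solver

  harmonic-split : ∀ m l k → harmonic m (l ℕ.+ k) ≡ harmonic m l ℚ.+ harmonic (m ℕ.+ l) k
  harmonic-split m l k = trans (Σ-split l k _)
    (cong (harmonic m l ℚ.+_)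
      (Σ-cong k (λ i → cong (λ t → + 1 ℚ./ suc t) (sym (ℕ.+-assoc m l i)))))

  harmonic-block : ∀ m l k → harmonic (m ℕ.* k) (suc l ℕ.* k) ≡
                   harmonic (m ℕ.* k) (l ℕ.* k) ℚ.+ harmonic ((m ℕ.+ l) ℕ.* k) k
  harmonic-block m l k = trans (cong (harmonic (m ℕ.* k)) (ℕ.+-comm k (l ℕ.* k)))
    (trans (harmonic-split (m ℕ.* k) (l ℕ.* k) k)
           (cong (λ t → harmonic (m ℕ.* k) (l ℕ.* k) ℚ.+ harmonic t k)
                 (sym (ℕ.*-distribʳ-+ k m l))))

  block-lower : ∀ q k → + 1 ℚ./ suc q ℚ.≤ harmonic (q ℕ.* suc k) (suc k)
  block-lower q k = begin
    + 1 ℚ./ suc q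
      ≤⟨ /-≤ 1 q (suc k ℕ.* 1) (k ℕ.+ q ℕ.* suc k) (ℕ.≤-reflexive eq) ⟩
    + (suc k ℕ.* 1) ℚ./ suc (k ℕ.+ q ℕ.* suc k)
      ≤⟨ Σ-mono-lower (suc k) 1 (k ℕ.+ q ℕ.* suc k) _ (λ i i<k →
           /-≤ 1 (k ℕ.+ q ℕ.* suc k) 1 (q ℕ.* suc k ℕ.+ i) (ℕ.*-monoʳ-≤ 1 (s≤s
             (subst (q ℕ.* suc k ℕ.+ i ℕ.≤_) (ℕ.+-comm (q ℕ.* suc k) k)
               (ℕ.+-monoʳ-≤ (q ℕ.* suc k) (ℕ.s≤s⁻¹ i<k)))))) ⟩
    harmonic (q ℕ.* suc k) (suc k) ∎
    where
    eq : 1 ℕ.* (suc q ℕ.* suc k) ≡ suc k ℕ.* 1 ℕ.* suc q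
    eq = trans (ℕ.*-identityˡ _) (trans (ℕ.*-comm (suc q) (suc k))
           (cong (ℕ._* suc q) (sym (ℕ.*-identityʳ (suc k)))))

  block-upper : ∀ q k → harmonic (suc q ℕ.* suc k) (suc k) ℚ.≤ + 1 ℚ./ suc q
  block-upper q k = begin
    harmonic (suc q ℕ.* suc k) (suc k)
      ≤⟨ Σ-mono-upper (suc k) 1 (k ℕ.+ q ℕ.* suc k) _ (λ i _ →
           /-≤ 1 (suc q ℕ.* suc k ℕ.+ i) 1 (k ℕ.+ q ℕ.* suc k) (ℕ.*-monoʳ-≤ 1
             (ℕ.m≤n⇒m≤1+n (ℕ.m≤m+n (suc q ℕ.* suc k) i)))) ⟩
    + (suc k ℕ.* 1) ℚ./ suc (k ℕ.+ q ℕ.* suc k)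
      ≤⟨ /-≤ (suc k ℕ.* 1) (k ℕ.+ q ℕ.* suc k) 1 q (ℕ.≤-reflexive eq) ⟩
    + 1 ℚ./ suc q ∎
    where
    eq : suc k ℕ.* 1 ℕ.* suc q ≡ 1 ℕ.* (suc q ℕ.* suc k)
    eq = trans (cong (ℕ._* suc q) (ℕ.*-identityʳ (suc k)))
           (trans (ℕ.*-comm (suc k) (suc q)) (sym (ℕ.*-identityˡ _)))

  refine-lower : ∀ m l k → harmonic m l ℚ.≤ harmonic (m ℕ.* suc k) (l ℕ.* suc k)
  refine-lower m zero    k = ℚ.≤-refl
  refine-lower m (suc l) k = begin
    harmonic m l ℚ.+ + 1 ℚ./ suc (m ℕ.+ l)
      ≤⟨ ℚ.+-mono-≤ (refine-lower m l k) (block-lower (m ℕ.+ l) k) ⟩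
    harmonic (m ℕ.* suc k) (l ℕ.* suc k) ℚ.+ harmonic ((m ℕ.+ l) ℕ.* suc k) (suc k)
      ≡⟨ harmonic-block m l (suc k) ⟨
    harmonic (m ℕ.* suc k) (suc l ℕ.* suc k) ∎

  refine-upper : ∀ m l k → harmonic (suc m ℕ.* suc k) (l ℕ.* suc k) ℚ.+ + 1 ℚ./ suc (m ℕ.+ l)
                           ℚ.≤ harmonic (suc m) l ℚ.+ + 1 ℚ./ suc m
  refine-upper m zero    k = ℚ.≤-reflexive (cong (λ t → 0ℚ ℚ.+ + 1 ℚ./ suc t) (ℕ.+-identityʳ m))
  refine-upper m (suc l) k = begin
    harmonic (suc m ℕ.* suc k) (suc l ℕ.* suc k) ℚ.+ + 1 ℚ./ suc (m ℕ.+ suc l)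
      ≡⟨ cong₂ (λ s t → s ℚ.+ + 1 ℚ./ suc t) (harmonic-block (suc m) l (suc k)) (ℕ.+-suc m l) ⟩
    A ℚ.+ harmonic (suc (m ℕ.+ l) ℕ.* suc k) (suc k) ℚ.+ D
      ≤⟨ ℚ.+-monoˡ-≤ D (ℚ.+-monoʳ-≤ A (block-upper (m ℕ.+ l) k)) ⟩
    A ℚ.+ + 1 ℚ./ suc (m ℕ.+ l) ℚ.+ D
      ≤⟨ ℚ.+-monoˡ-≤ D (refine-upper m l k) ⟩
    harmonic (suc m) l ℚ.+ + 1 ℚ./ suc m ℚ.+ D
      ≡⟨ solve 3 (λ a b c → a :+ b :+ c := a :+ c :+ b) refl (harmonic (suc m) l) (+ 1 ℚ./ suc m) D ⟩
    harmonic (suc m) l ℚ.+ D ℚ.+ + 1 ℚ./ suc m ∎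
    where
    A = harmonic (suc m ℕ.* suc k) (l ℕ.* suc k)
    D = + 1 ℚ./ suc (suc (m ℕ.+ l))

  close : ∀ n i j → log-approximation n i ℚ.≤ log-approximation n j ℚ.+ + 1 ℚ./ suc j
  close n i j = begin
    harmonic (suc i) (N ℕ.* suc i)
      ≤⟨ refine-lower (suc i) (N ℕ.* suc i) j ⟩
    harmonic (suc i ℕ.* suc j) (N ℕ.* suc i ℕ.* suc j)
      ≡⟨ cong₂ harmonic (ℕ.*-comm (suc i) (suc j))
           (trans (ℕ.*-assoc N (suc i) (suc j))
             (trans (cong (N ℕ.*_) (ℕ.*-comm (suc i) (suc j))) (sym (ℕ.*-assoc N (suc j) (suc i))))) ⟩
    harmonic (suc j ℕ.* suc i) (N ℕ.* suc j ℕ.* suc i)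
      ≤⟨ p≤p+q (ℚ.<⇒≤ (/-pos (j ℕ.+ N ℕ.* suc j))) ⟩
    harmonic (suc j ℕ.* suc i) (N ℕ.* suc j ℕ.* suc i) ℚ.+ + 1 ℚ./ suc (j ℕ.+ N ℕ.* suc j)
      ≤⟨ refine-upper j (N ℕ.* suc j) i ⟩
    harmonic (suc j) (N ℕ.* suc j) ℚ.+ + 1 ℚ./ suc j ∎
    where N = n ℕ.∸ 1

log : ℕ → ℝ
log n = fromApproximations (log-approximation n) (log-lemmas.close n)

1≤⇒0< : ∀ {x} → fromℕ 1 ≤ x → fromℕ 0 < x
1≤⇒0< {x} (mk≤ h) =
  let N , hN = h {½} (ℚ.positive⁻¹ ½)
  in mk< ½ (ℚ.positive⁻¹ ½) N λ i hi → begin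
    0ℚ ℚ.+ ½                ≡⟨⟩
    1ℚ ℚ.- ½                ≤⟨ ℚ.+-monoˡ-≤ (ℚ.- ½) (hN i hi) ⟩
    seq x i ℚ.+ ½ ℚ.- ½     ≡⟨ solve 1 (λ a → a :+ con ½ :- con ½ := a) refl (seq x i) ⟩
    seq x i                 ∎
  where
  open ℚ.≤-Reasoning
  open +-*-Solver

1≤√-approximation : ∀ {n} → 1 ℕ.< n → ∀ k → 1ℚ ℚ.≤ √-approximation n k
1≤√-approximation {n} 1<n k = /-≤ 1 0 (isqrt (n ℕ.* (K ℕ.* K))) k
  (subst₂ ℕ._≤_ (sym (ℕ.*-identityˡ K)) (sym (ℕ.*-identityʳ _))
    (ℕ.s≤s⁻¹ (square-cancel-< K (suc (isqrt (n ℕ.* (K ℕ.* K))))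
      (ℕ.≤-<-trans
        (subst (ℕ._≤ n ℕ.* (K ℕ.* K)) (ℕ.*-identityˡ (K ℕ.* K)) (ℕ.*-monoˡ-≤ (K ℕ.* K) (ℕ.<⇒≤ 1<n)))
        (isqrt-upper (n ℕ.* (K ℕ.* K)))))))
  where
  open ℚ-lemmas
  K = suc k

0<2√n-x : ∀ {n x} → 1 ℕ.< n → x ≤ √ n → fromℕ 0 < fromℕ 2 * √ n - x
0<2√n-x {n} {x} 1<n (mk≤ h) =
  let N , hN = h {½} (ℚ.positive⁻¹ ½)
  in mk< ½ (ℚ.positive⁻¹ ½) N λ i hi →
    let s = √-approximation n i in begin
    0ℚ ℚ.+ ½                              ≡⟨⟩
    1ℚ ℚ.- ½                              ≤⟨ ℚ.+-monoˡ-≤ (ℚ.- ½) (1≤√-approximation 1<n i) ⟩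
    s ℚ.- ½                               ≡⟨ solve 1 (λ s → s :- con ½ := con (+ 2 ℚ./ 1) :* s :- (s :+ con ½)) refl s ⟩
    (+ 2 ℚ./ 1) ℚ.* s ℚ.- (s ℚ.+ ½)       ≤⟨ ℚ.+-monoʳ-≤ ((+ 2 ℚ./ 1) ℚ.* s) (ℚ.neg-antimono-≤ (hN i hi)) ⟩
    (+ 2 ℚ./ 1) ℚ.* s ℚ.- seq x i         ∎
  where
  open ℚ.≤-Reasoning
  open +-*-Solver

{-# OPTIONS --safe #-}

-- Write kxy = ax + by - 1 and u = kx - b, v = ky - a, so that uy = ax - 1, vx = by - 1 and
-- k + uv = n.  Each of these relations makes one variable determine another one that is
-- smaller, as a residue, and with it the whole solution: u determines k ≤ u and x ≤ u,
-- k determines u < k, x determines u < x, likewise for v, and y determines x < y.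
-- With r = ⌊ √ n ⌋, every solution is determined in this way by a variable that is at most
-- about r, and sharing out the available values gives ρ ≤ 4 r - 2.
-- This already suffices: the log term is nonnegative, and the rest of the right-hand side is
-- at least 4 √ n - 1 for every admissible α.
module Submission where

open import Defs
open import Data.Fin using (Fin; toℕ; fromℕ<)
open import Data.Fin.Properties using (injective⇒≤; toℕ-fromℕ<; +↔⊎)
open import Data.Integer as ℤ using (ℤ; +_; -[1+_]; 1ℤ)
import Data.Integer.Properties as ℤ
open import Data.List using (List; length; lookup)
open import Data.List.Membership.Propositional using (_∈_)
open import Data.List.Membership.Propositional.Properties using (∈-lookup)
import Data.List.Relation.Unary.All as All
open import Data.List.Relation.Unary.AllPairs using (_∷_)
open import Data.List.Relation.Unary.Unique.Propositional using (Unique)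
open import Data.Nat as ℕ using (ℕ; zero; suc; _∸_; _%_; z≤n; s≤s; s≤s⁻¹; z<s; >-nonZero)
open import Data.Nat.Divisibility using (divides)
open import Data.Nat.DivMod using ([m+kn]%n≡m%n; m<n⇒m%n≡m)
import Data.Nat.Properties as ℕ
open import Data.Nat.Tactic.RingSolver using (solve-∀)
open import Data.Product using (∃; ∃-syntax; _×_; _,_; proj₁; proj₂; swap)
open import Data.Rational as ℚ using (ℚ; _/_; 0ℚ; 1ℚ; toℚᵘ)
import Data.Rational.Properties as ℚ
open import Data.Rational.Solver using (module +-*-Solver)
open import Data.Rational.Unnormalised as ℚᵘ using (mkℚᵘ)
import Data.Rational.Unnormalised.Properties as ℚᵘ
open import Data.Sum using (_⊎_; inj₁; inj₂)
open import Data.Sum.Function.Propositional using (_⊎-↔_)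
open import Function.Bundles using (_↣_; Injection)
open import Function.Properties.Inverse using (↔-refl; ↔-sym; ↔-trans; ↔⇒↣)
open import Relation.Binary.PropositionalEquality
  using (_≡_; refl; sym; trans; cong; cong₂; subst; module ≡-Reasoning)
open import Relation.Nullary using (Dec; yes; no; contradiction)

-- Counting a repetition-free list by charging its entries to slots

lookup-injective : ∀ {a} {A : Set a} {xs : List A} → Unique xs →
                   ∀ {i j} → lookup xs i ≡ lookup xs j → i ≡ j
lookup-injective (_ ∷ _)  {Fin.zero}  {Fin.zero}  _  = refl
lookup-injective (x∉ ∷ _) {Fin.zero}  {Fin.suc j} eq = contradiction eq (All.lookup x∉ (∈-lookup j))
lookup-injective (x∉ ∷ _) {Fin.suc i} {Fin.zero}  eq = contradiction (sym eq) (All.lookup x∉ (∈-lookup i))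
lookup-injective (_ ∷ u)  {Fin.suc _} {Fin.suc _} eq = cong Fin.suc (lookup-injective u eq)

-- Choosing a slot for each position gives an injection into `Fin n`: equal slots force equal
-- entries, hence equal positions. `R` is a relation and not a function, so that a charge can carry
-- the evidence that makes it injective.
length≤ : ∀ {a b r} {A : Set a} {B : Set b} {n} {xs : List A} (R : A → B → Set r) → B ↣ Fin n → Unique xs →
          (∀ {x} → x ∈ xs → ∃ (R x)) → (∀ {x y s} → R x s → R y s → x ≡ y) →
          length xs ℕ.≤ n
length≤ {n = n} {xs} R enum unique charge injective = injective⇒≤ {f = code} λ {i} {j} eq →
  lookup-injective unique (injective (proj₂ (charge (∈-lookup i)))
    (subst (R (lookup xs j)) (sym (Injection.injective enum eq)) (proj₂ (charge (∈-lookup j)))))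
  where
  code : Fin (length xs) → Fin n
  code i = Injection.to enum (proj₁ (charge (∈-lookup i)))

-- Uniqueness of residues

remainder-unique : ∀ {r r′ d} q q′ → r ℕ.< d → r′ ℕ.< d →
                   r ℕ.+ q ℕ.* d ≡ r′ ℕ.+ q′ ℕ.* d → r ≡ r′
remainder-unique {r} {r′} {d@(suc _)} q q′ r<d r′<d eq = begin
  r                        ≡⟨ m<n⇒m%n≡m r<d ⟨
  r % d                    ≡⟨ [m+kn]%n≡m%n r q d ⟨
  (r ℕ.+ q ℕ.* d) % d      ≡⟨ cong (_% d) eq ⟩
  (r′ ℕ.+ q′ ℕ.* d) % d    ≡⟨ [m+kn]%n≡m%n r′ q′ d ⟩
  r′ % d                   ≡⟨ m<n⇒m%n≡m r′<d ⟩
  r′                       ∎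
  where open ≡-Reasoning

-- Residues are taken in 1, ..., d here, for hypotheses such as k ≤ u that allow equality; lowering
-- both by one gives ordinary remainders.
positive-remainder-unique : ∀ {r r′ d} q q′ → 0 ℕ.< r → 0 ℕ.< r′ → r ℕ.≤ d → r′ ℕ.≤ d →
                            r ℕ.+ q ℕ.* d ≡ r′ ℕ.+ q′ ℕ.* d → r ≡ r′
positive-remainder-unique {suc _} {suc _} q q′ _ _ r≤d r′≤d eq =
  cong suc (remainder-unique q q′ r≤d r′≤d (ℕ.suc-injective eq))

*-cancelˡ : ∀ {m n o} → 0 ℕ.< o → o ℕ.* m ≡ o ℕ.* n → m ≡ n
*-cancelˡ {m} {n} {o} 0<o = ℕ.*-cancelˡ-≡ m n o {{>-nonZero 0<o}}

-- The variables k, u, v attached to a solution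

-- The relations are written without subtraction. The condition x < y is left out, so that
-- exchanging (a, x, u) with (b, y, v) is a symmetry, see `flip`.
record Decomposition (a b x y : ℕ) : Set where
  field
    k u v : ℕ
    0<x   : 0 ℕ.< x
    0<y   : 0 ℕ.< y
    0<k   : 0 ℕ.< k
    0<u   : 0 ℕ.< u
    0<v   : 0 ℕ.< v
    kx≡   : k ℕ.* x ≡ u ℕ.+ b
    ky≡   : k ℕ.* y ≡ v ℕ.+ a
    uy≡   : suc (u ℕ.* y) ≡ a ℕ.* x
    vx≡   : suc (v ℕ.* x) ≡ b ℕ.* y
    uv≡   : k ℕ.+ u ℕ.* v ≡ a ℕ.* b

decompose : ∀ {a b x y} k → 0 ℕ.< a → 0 ℕ.< b → 1 ℕ.< x → x ℕ.< y →
            suc (k ℕ.* (x ℕ.* y)) ≡ a ℕ.* x ℕ.+ b ℕ.* y → Decomposition a b x y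
decompose {a} {b} {x} {y} k 0<a 0<b 1<x x<y eq = record
  { k = k ; u = u ; v = v ; 0<x = 0<x ; 0<y = 0<y
  ; 0<k = ℕ.*-cancelʳ-< x 0 k (ℕ.≤-<-trans z≤n b<kx)
  ; 0<u = ℕ.m<n⇒0<n∸m b<kx ; 0<v = ℕ.m<n⇒0<n∸m a<ky
  ; kx≡ = kx ; ky≡ = ky ; uy≡ = uy ; vx≡ = vx ; uv≡ = uv }
  where
  u = k ℕ.* x ∸ b
  v = k ℕ.* y ∸ a
  0<x = ℕ.<-trans z<s 1<x
  0<y = ℕ.<-trans 0<x x<y

  -- Since cz > 1, the equation gives dw < mw. With m = kx and m = ky this makes u and v positive.
  exceeds : ∀ {c d z w} m → 0 ℕ.< c → 1 ℕ.< z → suc (m ℕ.* w) ≡ c ℕ.* z ℕ.+ d ℕ.* w → d ℕ.< m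
  exceeds {c} {d} {z} {w} m 0<c 1<z h = ℕ.*-cancelʳ-< w d m (s≤s⁻¹ (begin-strict
    1 ℕ.+ d ℕ.* w           <⟨ ℕ.+-monoˡ-< (d ℕ.* w) (ℕ.<-≤-trans 1<z (ℕ.m≤n*m z c {{>-nonZero 0<c}})) ⟩
    c ℕ.* z ℕ.+ d ℕ.* w     ≡⟨ h ⟨
    suc (m ℕ.* w)           ∎))
    where open ℕ.≤-Reasoning

  b<kx : b ℕ.< k ℕ.* x
  b<kx = exceeds (k ℕ.* x) 0<a 1<x (trans (cong suc (ℕ.*-assoc k x y)) eq)

  eq′ : suc (k ℕ.* y ℕ.* x) ≡ b ℕ.* y ℕ.+ a ℕ.* x
  eq′ = begin
    suc (k ℕ.* y ℕ.* x)     ≡⟨ cong suc (ℕ.*-assoc k y x) ⟩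
    suc (k ℕ.* (y ℕ.* x))   ≡⟨ cong (λ t → suc (k ℕ.* t)) (ℕ.*-comm y x) ⟩
    suc (k ℕ.* (x ℕ.* y))   ≡⟨ eq ⟩
    a ℕ.* x ℕ.+ b ℕ.* y     ≡⟨ ℕ.+-comm (a ℕ.* x) (b ℕ.* y) ⟩
    b ℕ.* y ℕ.+ a ℕ.* x     ∎
    where open ≡-Reasoning

  a<ky : a ℕ.< k ℕ.* y
  a<ky = exceeds (k ℕ.* y) 0<b (ℕ.<-trans 1<x x<y) eq′

  kx : k ℕ.* x ≡ u ℕ.+ b
  kx = sym (ℕ.m∸n+n≡m (ℕ.<⇒≤ b<kx))

  ky : k ℕ.* y ≡ v ℕ.+ a
  ky = sym (ℕ.m∸n+n≡m (ℕ.<⇒≤ a<ky))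

  uy : suc (u ℕ.* y) ≡ a ℕ.* x
  uy = ℕ.+-cancelʳ-≡ (b ℕ.* y) _ _ (begin
    suc (u ℕ.* y) ℕ.+ b ℕ.* y     ≡⟨ cong suc (ℕ.*-distribʳ-+ y u b) ⟨
    suc ((u ℕ.+ b) ℕ.* y)         ≡⟨ cong (λ t → suc (t ℕ.* y)) kx ⟨
    suc (k ℕ.* x ℕ.* y)           ≡⟨ cong suc (ℕ.*-assoc k x y) ⟩
    suc (k ℕ.* (x ℕ.* y))         ≡⟨ eq ⟩
    a ℕ.* x ℕ.+ b ℕ.* y           ∎)
    where open ≡-Reasoning

  vx : suc (v ℕ.* x) ≡ b ℕ.* y
  vx = ℕ.+-cancelʳ-≡ (a ℕ.* x) _ _ (begin
    suc (v ℕ.* x) ℕ.+ a ℕ.* x     ≡⟨ cong suc (ℕ.*-distribʳ-+ x v a) ⟨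
    suc ((v ℕ.+ a) ℕ.* x)         ≡⟨ cong (λ t → suc (t ℕ.* x)) ky ⟨
    suc (k ℕ.* y ℕ.* x)           ≡⟨ eq′ ⟩
    b ℕ.* y ℕ.+ a ℕ.* x           ∎)
    where open ≡-Reasoning

  uv : k ℕ.+ u ℕ.* v ≡ a ℕ.* b
  -- After adding ua, both sides equal kax: the left through k(uy + 1), the right through a(u + b).
  uv = ℕ.+-cancelʳ-≡ (u ℕ.* a) _ _ (begin
    k ℕ.+ u ℕ.* v ℕ.+ u ℕ.* a     ≡⟨ regroup k u v a ⟩
    k ℕ.+ u ℕ.* (v ℕ.+ a)         ≡⟨ cong (λ t → k ℕ.+ u ℕ.* t) ky ⟨
    k ℕ.+ u ℕ.* (k ℕ.* y)         ≡⟨ factor k u y ⟩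
    k ℕ.* suc (u ℕ.* y)           ≡⟨ cong (k ℕ.*_) uy ⟩
    k ℕ.* (a ℕ.* x)               ≡⟨ shuffle k a x ⟩
    a ℕ.* (k ℕ.* x)               ≡⟨ cong (a ℕ.*_) kx ⟩
    a ℕ.* (u ℕ.+ b)               ≡⟨ expand a u b ⟩
    a ℕ.* b ℕ.+ u ℕ.* a           ∎)
    where
    open ≡-Reasoning
    regroup : ∀ k u v a → k ℕ.+ u ℕ.* v ℕ.+ u ℕ.* a ≡ k ℕ.+ u ℕ.* (v ℕ.+ a)
    regroup = solve-∀
    factor : ∀ k u y → k ℕ.+ u ℕ.* (k ℕ.* y) ≡ k ℕ.* suc (u ℕ.* y)
    factor = solve-∀
    shuffle : ∀ k a x → k ℕ.* (a ℕ.* x) ≡ a ℕ.* (k ℕ.* x)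
    shuffle = solve-∀
    expand : ∀ a u b → a ℕ.* (u ℕ.+ b) ≡ a ℕ.* b ℕ.+ u ℕ.* a
    expand = solve-∀

decompose-solution : ∀ {a b p} → 0 ℕ.< a → 0 ℕ.< b → Solution a b p →
  ∃[ x ] ∃[ y ] (p ≡ (+ x , + y) × 1 ℕ.< x × x ℕ.< y × Decomposition a b x y)
decompose-solution {suc a} {b} {+ suc x , + y} 0<a 0<b (ℤ.+<+ 1<x , ℤ.+<+ x<y , divides k eq) =
  suc x , y , refl , 1<x , x<y , decompose k 0<a 0<b 1<x x<y (sym (begin
    suc a ℕ.* suc x ℕ.+ b ℕ.* y
      -- With a and x successors, ax + by - 1 computes to a natural number once by is one, so the
      -- absolute value disappears.
      ≡⟨ cong (λ t → suc ℤ.∣ (+ suc a) ℤ.* (+ suc x) ℤ.+ t ℤ.- 1ℤ ∣) (ℤ.pos-* b y) ⟩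
    suc ℤ.∣ (+ suc a) ℤ.* (+ suc x) ℤ.+ (+ b) ℤ.* (+ y) ℤ.- 1ℤ ∣
      ≡⟨ cong suc eq ⟩
    suc (k ℕ.* ℤ.∣ (+ suc x) ℤ.* (+ y) ∣)
      ≡⟨ cong (λ t → suc (k ℕ.* t)) (ℤ.abs-* (+ suc x) (+ y)) ⟩
    suc (k ℕ.* (suc x ℕ.* y)) ∎))
  where open ≡-Reasoning
decompose-solution {p = + zero , _}            _ _ (ℤ.+<+ () , _)
decompose-solution {p = + suc _ , -[1+ _ ]}    _ _ (_ , () , _)
decompose-solution {p = -[1+ _ ] , _}          _ _ (() , _)

flip : ∀ {a b x y} → Decomposition a b x y → Decomposition b a y x
flip {a} {b} D = record
  { k = k ; u = v ; v = u ; 0<x = 0<y ; 0<y = 0<x ; 0<k = 0<k ; 0<u = 0<v ; 0<v = 0<u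
  ; kx≡ = ky≡ ; ky≡ = kx≡ ; uy≡ = vx≡ ; vx≡ = uy≡
  ; uv≡ = trans (cong (k ℕ.+_) (ℕ.*-comm v u)) (trans uv≡ (ℕ.*-comm a b)) }
  where open Decomposition D

-- Which variables determine a solution

module _ {a b : ℕ} where
  open Decomposition

  private variable
    x y x′ y′ : ℕ

  ux-determines : (D : Decomposition a b x y) (D′ : Decomposition a b x′ y′) →
                  u D ≡ u D′ → x ≡ x′ → x ≡ x′ × y ≡ y′
  ux-determines D D′ refl refl =
    refl , *-cancelˡ (0<u D) (ℕ.suc-injective (trans (uy≡ D) (sym (uy≡ D′))))

  ku-determines : (D : Decomposition a b x y) (D′ : Decomposition a b x′ y′) →
                  k D ≡ k D′ → u D ≡ u D′ → x ≡ x′ × y ≡ y′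
  ku-determines D D′ refl refl =
    ux-determines D D′ refl (*-cancelˡ (0<k D) (trans (kx≡ D) (sym (kx≡ D′))))

  -- By k + uv = n, k is the residue of n modulo u in the range 1, ..., u.
  u-determines-k : (D : Decomposition a b x y) (D′ : Decomposition a b x′ y′) →
                   u D ≡ u D′ → k D ℕ.≤ u D → k D′ ℕ.≤ u D′ → x ≡ x′ × y ≡ y′
  u-determines-k D D′ refl k≤u k′≤u = ku-determines D D′
    (positive-remainder-unique (v D) (v D′) (0<k D) (0<k D′) k≤u k′≤u (begin
      k D ℕ.+ v D ℕ.* u D       ≡⟨ cong (k D ℕ.+_) (ℕ.*-comm (v D) (u D)) ⟩
      k D ℕ.+ u D ℕ.* v D       ≡⟨ trans (uv≡ D) (sym (uv≡ D′)) ⟩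
      k D′ ℕ.+ u D ℕ.* v D′     ≡⟨ cong (k D′ ℕ.+_) (ℕ.*-comm (u D) (v D′)) ⟩
      k D′ ℕ.+ v D′ ℕ.* u D     ∎)) refl
    where open ≡-Reasoning

  -- By ax = uy + 1, x is inverse to a modulo u. No inverse is formed: expanding axx′ in two ways
  -- gives x ≡ axx′ ≡ x′ modulo u.
  u-determines-x : (D : Decomposition a b x y) (D′ : Decomposition a b x′ y′) →
                   u D ≡ u D′ → x ℕ.≤ u D → x′ ℕ.≤ u D′ → x ≡ x′ × y ≡ y′
  u-determines-x {x} {y} {x′} {y′} D D′ refl x≤u x′≤u = ux-determines D D′ refl
    (positive-remainder-unique (x ℕ.* y′) (x′ ℕ.* y) (0<x D) (0<x D′) x≤u x′≤u (begin
      x ℕ.+ x ℕ.* y′ ℕ.* u D     ≡⟨ factor x y′ (u D) ⟩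
      x ℕ.* suc (u D ℕ.* y′)     ≡⟨ cong (x ℕ.*_) (uy≡ D′) ⟩
      x ℕ.* (a ℕ.* x′)           ≡⟨ shuffle x a x′ ⟩
      x′ ℕ.* (a ℕ.* x)           ≡⟨ cong (x′ ℕ.*_) (uy≡ D) ⟨
      x′ ℕ.* suc (u D ℕ.* y)     ≡⟨ factor x′ y (u D) ⟨
      x′ ℕ.+ x′ ℕ.* y ℕ.* u D    ∎))
    where
    open ≡-Reasoning
    factor : ∀ x y u → x ℕ.+ x ℕ.* y ℕ.* u ≡ x ℕ.* suc (u ℕ.* y)
    factor = solve-∀
    shuffle : ∀ x a x′ → x ℕ.* (a ℕ.* x′) ≡ x′ ℕ.* (a ℕ.* x)
    shuffle = solve-∀

  -- The same expansion of axx′, now read modulo y.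
  y-determines-x : (D : Decomposition a b x y) (D′ : Decomposition a b x′ y′) →
                   y ≡ y′ → x ℕ.< y → x′ ℕ.< y′ → x ≡ x′ × y ≡ y′
  y-determines-x {x} {y} {x′} D D′ refl x<y x′<y =
    remainder-unique (x ℕ.* u D′) (x′ ℕ.* u D) x<y x′<y (begin
      x ℕ.+ x ℕ.* u D′ ℕ.* y     ≡⟨ factor x (u D′) y ⟩
      x ℕ.* suc (u D′ ℕ.* y)     ≡⟨ cong (x ℕ.*_) (uy≡ D′) ⟩
      x ℕ.* (a ℕ.* x′)           ≡⟨ shuffle x a x′ ⟩
      x′ ℕ.* (a ℕ.* x)           ≡⟨ cong (x′ ℕ.*_) (uy≡ D) ⟨
      x′ ℕ.* suc (u D ℕ.* y)     ≡⟨ factor x′ (u D) y ⟨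
      x′ ℕ.+ x′ ℕ.* u D ℕ.* y    ∎) , refl
    where
    open ≡-Reasoning
    factor : ∀ x u y → x ℕ.+ x ℕ.* u ℕ.* y ≡ x ℕ.* suc (u ℕ.* y)
    factor = solve-∀
    shuffle : ∀ x a x′ → x ℕ.* (a ℕ.* x′) ≡ x′ ℕ.* (a ℕ.* x)
    shuffle = solve-∀

  -- kx′ + u = kx + u′, as both equal u + u′ + b.
  k-determines-u : (D : Decomposition a b x y) (D′ : Decomposition a b x′ y′) →
                   k D ≡ k D′ → u D ℕ.< k D → u D′ ℕ.< k D′ → x ≡ x′ × y ≡ y′
  k-determines-u {x} {_} {x′} D D′ refl u<k u′<k = ku-determines D D′ refl
    (remainder-unique x′ x u<k u′<k (begin
      u D ℕ.+ x′ ℕ.* k D          ≡⟨ cong (u D ℕ.+_) (trans (ℕ.*-comm x′ (k D)) (kx≡ D′)) ⟩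
      u D ℕ.+ (u D′ ℕ.+ b)        ≡⟨ shuffle (u D) (u D′) b ⟩
      u D′ ℕ.+ (u D ℕ.+ b)        ≡⟨ cong (u D′ ℕ.+_) (trans (ℕ.*-comm x (k D)) (kx≡ D)) ⟨
      u D′ ℕ.+ x ℕ.* k D          ∎))
    where
    open ≡-Reasoning
    shuffle : ∀ u u′ b → u ℕ.+ (u′ ℕ.+ b) ≡ u′ ℕ.+ (u ℕ.+ b)
    shuffle = solve-∀

  -- By kx = u + b, u is congruent to -b modulo x; this is `k-determines-u` with k and x exchanged.
  x-determines-u : (D : Decomposition a b x y) (D′ : Decomposition a b x′ y′) →
                   x ≡ x′ → u D ℕ.< x → u D′ ℕ.< x′ → x ≡ x′ × y ≡ y′
  x-determines-u {x} D D′ refl u<x u′<x = ux-determines D D′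
    (remainder-unique (k D′) (k D) u<x u′<x (begin
      u D ℕ.+ k D′ ℕ.* x          ≡⟨ cong (u D ℕ.+_) (kx≡ D′) ⟩
      u D ℕ.+ (u D′ ℕ.+ b)        ≡⟨ shuffle (u D) (u D′) b ⟩
      u D′ ℕ.+ (u D ℕ.+ b)        ≡⟨ cong (u D′ ℕ.+_) (kx≡ D) ⟨
      u D′ ℕ.+ k D ℕ.* x          ∎)) refl
    where
    open ≡-Reasoning
    shuffle : ∀ u u′ b → u ℕ.+ (u′ ℕ.+ b) ≡ u′ ℕ.+ (u ℕ.+ b)
    shuffle = solve-∀

-- Slots and the resulting bound on ρ

-- With r = q + 1 there are 2r + 2(r - 1) = 4r - 2 slots. The larger classes serve variables with
-- values 1, ..., r, the smaller ones variables that skip one value.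
Slot : ℕ → Set
Slot q = Fin (suc q) ⊎ Fin (suc q) ⊎ Fin q ⊎ Fin q

slots↣Fin : ∀ q → Slot q ↣ Fin (suc q ℕ.+ (suc q ℕ.+ (q ℕ.+ q)))
slots↣Fin q = ↔⇒↣ (↔-sym (↔-trans +↔⊎ (↔-refl ⊎-↔ ↔-trans +↔⊎ (↔-refl ⊎-↔ +↔⊎))))

offset : ∀ c {q m} → c ℕ.≤ m → m ℕ.< c ℕ.+ q → ∃[ i ] m ≡ c ℕ.+ toℕ {q} i
offset c {q} {m} c≤m m<c+q = fromℕ< m∸c<q ,
  trans (sym (ℕ.m+[n∸m]≡n c≤m)) (cong (c ℕ.+_) (sym (toℕ-fromℕ< m∸c<q)))
  where
  m∸c<q : m ∸ c ℕ.< q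
  m∸c<q = ℕ.+-cancelˡ-< c _ _ (subst (ℕ._< c ℕ.+ q) (sym (ℕ.m+[n∸m]≡n c≤m)) m<c+q)

ρ≤slots : ∀ {a b q} (C : ∀ {x y} → Decomposition a b x y → Slot q → Set) → 0 ℕ.< a → 0 ℕ.< b →
          (∀ {x y} (D : Decomposition a b x y) → 1 ℕ.< x → x ℕ.< y → ∃ (C D)) →
          (∀ {x y x′ y′ s} (D : Decomposition a b x y) (D′ : Decomposition a b x′ y′) →
            x ℕ.< y → x′ ℕ.< y′ → C D s → C D′ s → x ≡ x′ × y ≡ y′) →
          ρ a b ℕ.≤ suc q ℕ.+ (suc q ℕ.+ (q ℕ.+ q))
ρ≤slots {a} {b} {q} C 0<a 0<b charge unique = length≤ R (slots↣Fin q) (solutions-unique a b)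
  (λ p∈ → let x , y , p≡ , 1<x , x<y , D = decompose-solution 0<a 0<b (solutions-sound a b p∈)
              s , c = charge D 1<x x<y
          in s , x , y , p≡ , x<y , D , c)
  λ { (_ , _ , refl , x<y , D , c) (_ , _ , refl , x′<y′ , D′ , c′) →
      let x≡ , y≡ = unique D D′ x<y x′<y′ c c′ in cong₂ (λ s t → + s , + t) x≡ y≡ }
  where
  -- The decomposition is packed with the charge, so that two charges of one slot can be compared
  -- without knowing that decompositions are unique.
  R : ℤ × ℤ → Slot q → Set
  R p s = ∃[ x ] ∃[ y ] (p ≡ (+ x , + y) × x ℕ.< y × ∃[ D ] C {x} {y} D s)

-- Charging the solutions, separately for b ≤ a and a ≤ b

module _ {a b q : ℕ} (0<a : 0 ℕ.< a) (0<b : 0 ℕ.< b)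
         (n<[2+q]² : a ℕ.* b ℕ.< suc (suc q) ℕ.* suc (suc q)) where
  open Decomposition

  private
    r : ℕ
    r = suc q

    min≤r : ∀ {c d} → c ℕ.* d ℕ.≤ a ℕ.* b → c ℕ.≤ d → c ℕ.≤ r
    min≤r {c} {d} cd≤ c≤d = s≤s⁻¹ (square-cancel-< c (suc r)
      (ℕ.≤-<-trans (ℕ.*-monoʳ-≤ c c≤d) (ℕ.≤-<-trans cd≤ n<[2+q]²)))

    some≤r : ∀ c d → c ℕ.* d ℕ.≤ a ℕ.* b → c ℕ.≤ r ⊎ d ℕ.≤ r
    some≤r c d cd≤ with ℕ.≤-total c d
    ... | inj₁ c≤d = inj₁ (min≤r cd≤ c≤d)
    ... | inj₂ d≤c = inj₂ (min≤r (subst (ℕ._≤ a ℕ.* b) (ℕ.*-comm c d) cd≤) d≤c)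

  -- by-k and by-v may share their slots: the former takes values below b, the latter from b on.
  data Charge≥ {x y} (D : Decomposition a b x y) : Slot q → Set where
    by-u  : ∀ {i} → k D ℕ.≤ u D → u D ≡ 1 ℕ.+ toℕ i → Charge≥ D (inj₁ i)
    by-k  : ∀ {i} → k D ℕ.< b → u D ℕ.< k D → k D ≡ 1 ℕ.+ toℕ i → Charge≥ D (inj₂ (inj₁ i))
    by-v  : ∀ {i} → b ℕ.≤ v D → k D ℕ.≤ v D → v D ≡ 1 ℕ.+ toℕ i → Charge≥ D (inj₂ (inj₁ i))
    by-k′ : ∀ {i} → v D ℕ.< k D → k D ≡ 2 ℕ.+ toℕ i → Charge≥ D (inj₂ (inj₂ (inj₁ i)))
    by-y  : ∀ {i} → y ≡ 3 ℕ.+ toℕ i → Charge≥ D (inj₂ (inj₂ (inj₂ i)))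

  Charge≥-unique : ∀ {x y x′ y′ s} (D : Decomposition a b x y) (D′ : Decomposition a b x′ y′) →
                   x ℕ.< y → x′ ℕ.< y′ → Charge≥ D s → Charge≥ D′ s → x ≡ x′ × y ≡ y′
  Charge≥-unique D D′ _ _ (by-u h e) (by-u h′ e′) = u-determines-k D D′ (trans e (sym e′)) h h′
  Charge≥-unique D D′ _ _ (by-k _ h e) (by-k _ h′ e′) = k-determines-u D D′ (trans e (sym e′)) h h′
  Charge≥-unique D D′ _ _ (by-k k<b _ e) (by-v b≤v _ e′) =
    contradiction b≤v (ℕ.<⇒≱ (subst (ℕ._< b) (trans e (sym e′)) k<b))
  Charge≥-unique D D′ _ _ (by-v b≤v _ e) (by-k k<b _ e′) =
    contradiction b≤v (ℕ.<⇒≱ (subst (ℕ._< b) (trans e′ (sym e)) k<b))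
  -- Charges to v are the charges to u of the flipped decomposition.
  Charge≥-unique D D′ _ _ (by-v _ h e) (by-v _ h′ e′) =
    swap (u-determines-k (flip D) (flip D′) (trans e (sym e′)) h h′)
  Charge≥-unique D D′ _ _ (by-k′ h e) (by-k′ h′ e′) =
    swap (k-determines-u (flip D) (flip D′) (trans e (sym e′)) h h′)
  Charge≥-unique D D′ x<y x′<y′ (by-y e) (by-y e′) = y-determines-x D D′ (trans e (sym e′)) x<y x′<y′

  -- As uv ≤ n, one of u, v is at most r. If k ≤ r too, the larger of k and that variable is
  -- charged. If k > r, then u ≤ r is impossible because 2k ≤ kx = u + b ≤ 2r, and v ≤ r leaves a
  -- small y: (r + 1)y ≤ ky = v + a < (r + 1)(r + 2).
  charge≥ : b ℕ.≤ a → ∀ {x y} (D : Decomposition a b x y) → 1 ℕ.< x → x ℕ.< y → ∃ (Charge≥ D)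
  charge≥ b≤a {x} {y} D 1<x x<y = split (some≤r (u D) (v D) uv≤n) (k D ℕ.≤? r)
    where
    open ℕ.≤-Reasoning

    uv≤n : u D ℕ.* v D ℕ.≤ a ℕ.* b
    uv≤n = subst (u D ℕ.* v D ℕ.≤_) (uv≡ D) (ℕ.m≤n+m _ (k D))

    b≤r : b ℕ.≤ r
    b≤r = min≤r (ℕ.≤-reflexive (ℕ.*-comm b a)) b≤a

    a≤n : a ℕ.≤ a ℕ.* b
    a≤n = ℕ.m≤m*n a b {{>-nonZero 0<b}}

    b≤v : b ℕ.≤ v D
    b≤v = ℕ.*-cancelʳ-≤ b (v D) x {{>-nonZero (0<x D)}} (s≤s⁻¹ (begin-strict
      b ℕ.* x              <⟨ ℕ.*-monoʳ-< b {{>-nonZero 0<b}} x<y ⟩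
      b ℕ.* y              ≡⟨ vx≡ D ⟨
      suc (v D ℕ.* x)      ∎))

    2k≤u+b : k D ℕ.+ k D ℕ.≤ u D ℕ.+ b
    2k≤u+b = begin
      k D ℕ.+ k D     ≡⟨ double (k D) ⟩
      k D ℕ.* 2       ≤⟨ ℕ.*-monoʳ-≤ (k D) 1<x ⟩
      k D ℕ.* x       ≡⟨ kx≡ D ⟩
      u D ℕ.+ b       ∎
      where
      double : ∀ k → k ℕ.+ k ≡ k ℕ.* 2
      double = solve-∀

    u<k⇒k<b : u D ℕ.< k D → k D ℕ.< b
    u<k⇒k<b u<k = ℕ.+-cancelˡ-< (k D) (k D) b (ℕ.≤-<-trans 2k≤u+b (ℕ.+-monoˡ-< b u<k))

    y<2+r : r ℕ.< k D → v D ℕ.≤ r → y ℕ.< 3 ℕ.+ q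
    y<2+r r<k v≤r = ℕ.*-cancelˡ-< (suc r) y (3 ℕ.+ q) (begin-strict
      suc r ℕ.* y                      ≤⟨ ℕ.*-monoˡ-≤ y r<k ⟩
      k D ℕ.* y                        ≡⟨ ky≡ D ⟩
      v D ℕ.+ a                        ≤⟨ ℕ.+-mono-≤ v≤r a≤n ⟩
      r ℕ.+ a ℕ.* b                    <⟨ ℕ.+-mono-< (ℕ.n<1+n r) n<[2+q]² ⟩
      suc r ℕ.+ suc r ℕ.* suc r        ≡⟨ ℕ.*-suc (suc r) (suc r) ⟨
      suc r ℕ.* (3 ℕ.+ q)              ∎)

    split : u D ℕ.≤ r ⊎ v D ℕ.≤ r → Dec (k D ℕ.≤ r) → ∃ (Charge≥ D)
    split (inj₁ u≤r) (no k≰r) = contradiction 2k≤u+b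
      (ℕ.<⇒≱ (ℕ.≤-<-trans (ℕ.+-mono-≤ u≤r b≤r) (ℕ.+-mono-< (ℕ.≰⇒> k≰r) (ℕ.≰⇒> k≰r))))
    split (inj₂ v≤r) (no k≰r) =
      -- Although y can be as large as r + 1, 1 < x < y makes it at least 3, so r - 1 slots are
      -- enough.
      let i , e = offset 3 (ℕ.≤-trans (s≤s 1<x) x<y)
                    (y<2+r (ℕ.≰⇒> k≰r) v≤r)
      in _ , by-y e
    split (inj₁ u≤r) (yes k≤r) with k D ℕ.≤? u D
    ... | yes k≤u = let i , e = offset 1 (0<u D) (s≤s u≤r) in _ , by-u k≤u e
    ... | no k≰u  = let i , e = offset 1 (0<k D) (s≤s k≤r)
                        u<k = ℕ.≰⇒> k≰u
                    in _ , by-k (u<k⇒k<b u<k) u<k e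
    split (inj₂ v≤r) (yes k≤r) with k D ℕ.≤? v D
    ... | yes k≤v = let i , e = offset 1 (0<v D) (s≤s v≤r) in _ , by-v b≤v k≤v e
    -- Here k > v ≥ 1, so k starts at 2.
    ... | no k≰v  = let i , e = offset 2 (ℕ.≤-<-trans (0<v D) (ℕ.≰⇒> k≰v)) (s≤s k≤r)
                    in _ , by-k′ (ℕ.≰⇒> k≰v) e

  data Charge< {x y} (D : Decomposition a b x y) : Slot q → Set where
    by-u  : ∀ {i} → k D ℕ.≤ u D → u D ≡ 1 ℕ.+ toℕ i → Charge< D (inj₁ i)
    by-u′ : ∀ {i} → x ℕ.≤ u D → u D ≡ 1 ℕ.+ toℕ i → Charge< D (inj₂ (inj₁ i))
    by-k  : ∀ {i} → u D ℕ.< k D → k D ≡ 2 ℕ.+ toℕ i → Charge< D (inj₂ (inj₂ (inj₁ i)))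
    by-x  : ∀ {i} → u D ℕ.< x → x ≡ 2 ℕ.+ toℕ i → Charge< D (inj₂ (inj₂ (inj₂ i)))

  Charge<-unique : ∀ {x y x′ y′ s} (D : Decomposition a b x y) (D′ : Decomposition a b x′ y′) →
                   x ℕ.< y → x′ ℕ.< y′ → Charge< D s → Charge< D′ s → x ≡ x′ × y ≡ y′
  Charge<-unique D D′ _ _ (by-u h e)  (by-u h′ e′)  = u-determines-k D D′ (trans e (sym e′)) h h′
  Charge<-unique D D′ _ _ (by-u′ h e) (by-u′ h′ e′) = u-determines-x D D′ (trans e (sym e′)) h h′
  Charge<-unique D D′ _ _ (by-k h e)  (by-k h′ e′)  = k-determines-u D D′ (trans e (sym e′)) h h′
  Charge<-unique D D′ _ _ (by-x h e)  (by-x h′ e′)  = x-determines-u D D′ (trans e (sym e′)) h h′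

  -- Now u < a ≤ r always holds, so u is charged as soon as k ≤ u or x ≤ u. Otherwise k and x both
  -- exceed u and are at least 2, and kx = u + b ≤ (u + 1)b ≤ n makes one of them at most r.
  charge< : a ℕ.≤ b → ∀ {x y} (D : Decomposition a b x y) → 1 ℕ.< x → x ℕ.< y → ∃ (Charge< D)
  charge< a≤b {x} {y} D 1<x x<y = split (k D ℕ.≤? u D) (x ℕ.≤? u D)
    where
    open ℕ.≤-Reasoning

    u<a : u D ℕ.< a
    u<a = ℕ.*-cancelʳ-< y (u D) a (begin-strict
      u D ℕ.* y            <⟨ ℕ.n<1+n _ ⟩
      suc (u D ℕ.* y)      ≡⟨ uy≡ D ⟩
      a ℕ.* x              ≤⟨ ℕ.*-monoʳ-≤ a (ℕ.<⇒≤ x<y) ⟩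
      a ℕ.* y              ∎)

    u≤r : u D ℕ.≤ r
    u≤r = ℕ.≤-trans (ℕ.<⇒≤ u<a) (min≤r ℕ.≤-refl a≤b)

    kx≤n : k D ℕ.* x ℕ.≤ a ℕ.* b
    kx≤n = begin
      k D ℕ.* x            ≡⟨ kx≡ D ⟩
      u D ℕ.+ b            ≤⟨ ℕ.+-monoˡ-≤ b (ℕ.m≤m*n (u D) b {{>-nonZero 0<b}}) ⟩
      u D ℕ.* b ℕ.+ b      ≡⟨ ℕ.+-comm (u D ℕ.* b) b ⟩
      suc (u D) ℕ.* b      ≤⟨ ℕ.*-monoˡ-≤ b u<a ⟩
      a ℕ.* b              ∎

    split : Dec (k D ℕ.≤ u D) → Dec (x ℕ.≤ u D) → ∃ (Charge< D)
    split (yes k≤u) _ = let i , e = offset 1 (0<u D) (s≤s u≤r) in _ , by-u k≤u e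
    split (no _) (yes x≤u) = let i , e = offset 1 (0<u D) (s≤s u≤r) in _ , by-u′ x≤u e
    split (no k≰u) (no x≰u) with some≤r (k D) x kx≤n
    ... | inj₁ k≤r = let i , e = offset 2 (ℕ.≤-<-trans (0<u D) (ℕ.≰⇒> k≰u)) (s≤s k≤r)
                     in _ , by-k (ℕ.≰⇒> k≰u) e
    ... | inj₂ x≤r = let i , e = offset 2 1<x (s≤s x≤r) in _ , by-x (ℕ.≰⇒> x≰u) e

  -- The condition x < y breaks the symmetry between a and b, so the two orders need different
  -- charges.
  ρ≤4q+2 : ρ a b ℕ.≤ suc q ℕ.+ (suc q ℕ.+ (q ℕ.+ q))
  ρ≤4q+2 with ℕ.≤-total a b
  ... | inj₁ a≤b = ρ≤slots Charge< 0<a 0<b (charge< a≤b) Charge<-unique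
  ... | inj₂ b≤a = ρ≤slots Charge≥ 0<a 0<b (charge≥ b≤a) Charge≥-unique

ρ+2≤4√n : ∀ {a b} → 0 ℕ.< a → 0 ℕ.< b → ρ a b ℕ.+ 2 ℕ.≤ 4 ℕ.* isqrt (a ℕ.* b)
ρ+2≤4√n {a} {b} 0<a 0<b with isqrt (a ℕ.* b) | isqrt-upper (a ℕ.* b)
... | zero  | n<1 = contradiction (ℕ.*-mono-≤ 0<a 0<b) (ℕ.<⇒≱ n<1)
... | suc q | n<  = subst (ρ a b ℕ.+ 2 ℕ.≤_) (total q) (ℕ.+-monoˡ-≤ 2 (ρ≤4q+2 0<a 0<b n<))
  where
  total : ∀ q → suc q ℕ.+ (suc q ℕ.+ (q ℕ.+ q)) ℕ.+ 2 ≡ 4 ℕ.* suc q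
  total = solve-∀

-- Inequalities for the rational approximations

open ℚ-lemmas
open +-*-Solver

/-* : ∀ p q d e → (+ p / suc d) ℚ.* (+ q / suc e) ≡ + (p ℕ.* q) / (suc d ℕ.* suc e)
/-* p q d e = ℚ.toℚᵘ-injective (begin
  toℚᵘ ((+ p / suc d) ℚ.* (+ q / suc e))           ≈⟨ ℚ.toℚᵘ-homo-* (+ p / suc d) (+ q / suc e) ⟩
  toℚᵘ (+ p / suc d) ℚᵘ.* toℚᵘ (+ q / suc e)       ≈⟨ ℚᵘ.*-cong (toℚᵘ-/ p d) (toℚᵘ-/ q e) ⟩
  mkℚᵘ (+ p ℤ.* + q) (e ℕ.+ d ℕ.* suc e)           ≡⟨ cong (λ t → mkℚᵘ t (e ℕ.+ d ℕ.* suc e)) (ℤ.pos-* p q) ⟨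
  mkℚᵘ (+ (p ℕ.* q)) (e ℕ.+ d ℕ.* suc e)           ≈⟨ toℚᵘ-/ (p ℕ.* q) (e ℕ.+ d ℕ.* suc e) ⟨
  toℚᵘ (+ (p ℕ.* q) / (suc d ℕ.* suc e))           ∎)
  where open ℚᵘ.≃-Reasoning

0≤* : ∀ {p q} → 0ℚ ℚ.≤ p → 0ℚ ℚ.≤ q → 0ℚ ℚ.≤ p ℚ.* q
0≤* {p} {q} 0≤p 0≤q =
  subst (ℚ._≤ p ℚ.* q) (ℚ.*-zeroʳ p) (ℚ.*-monoˡ-≤-nonNeg p {{ℚ.nonNegative 0≤p}} 0≤q)

0≤+ : ∀ {p q} → 0ℚ ℚ.≤ p → 0ℚ ℚ.≤ q → 0ℚ ℚ.≤ p ℚ.+ q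
0≤+ = ℚ.+-mono-≤

0≤p² : ∀ p → 0ℚ ℚ.≤ p ℚ.* p
0≤p² p with ℚ.≤-total 0ℚ p
... | inj₁ 0≤p = 0≤* 0≤p 0≤p
... | inj₂ p≤0 = subst (0ℚ ℚ.≤_) (solve 1 (λ p → (:- p) :* (:- p) := p :* p) refl p)
                   (0≤* (ℚ.neg-antimono-≤ p≤0) (ℚ.neg-antimono-≤ p≤0))

p≤q⇒0≤q-p : ∀ {p q} → p ℚ.≤ q → 0ℚ ℚ.≤ q ℚ.- p
p≤q⇒0≤q-p {p} {q} p≤q = subst (ℚ._≤ q ℚ.- p) (ℚ.+-inverseʳ p) (ℚ.+-monoˡ-≤ (ℚ.- p) p≤q)

-- From (rK)² ≤ nK² < (R + 1)². This carries the integer bound over to every term of the sequence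
-- for √ n.
isqrt≤√ : ∀ n k → + isqrt n / 1 ℚ.≤ √-approximation n k
isqrt≤√ n k = /-≤ r 0 R k (subst (r ℕ.* K ℕ.≤_) (sym (ℕ.*-identityʳ R))
  (s≤s⁻¹ (square-cancel-< (r ℕ.* K) (suc R) (begin-strict
    (r ℕ.* K) ℕ.* (r ℕ.* K)     ≡⟨ regroup r K ⟩
    (r ℕ.* r) ℕ.* (K ℕ.* K)     ≤⟨ ℕ.*-monoˡ-≤ (K ℕ.* K) (isqrt-lower n) ⟩
    n ℕ.* (K ℕ.* K)             <⟨ isqrt-upper (n ℕ.* (K ℕ.* K)) ⟩
    suc R ℕ.* suc R             ∎))))
  where
  open ℕ.≤-Reasoning
  K = suc k
  r = isqrt n
  R = isqrt (n ℕ.* (K ℕ.* K))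
  regroup : ∀ r K → (r ℕ.* K) ℕ.* (r ℕ.* K) ≡ (r ℕ.* r) ℕ.* (K ℕ.* K)
  regroup = solve-∀

-- The approximations come from below. This one-sided bound suffices, as n enters the right-hand
-- side of `4s-1≤` with a nonnegative coefficient.
√²≤ : ∀ n k → √-approximation n k ℚ.* √-approximation n k ℚ.≤ + n / 1
√²≤ n k = subst (ℚ._≤ + n / 1) (sym (/-* R R k k))
  (/-≤ (R ℕ.* R) (k ℕ.+ k ℕ.* suc k) n 0
    (subst (ℕ._≤ n ℕ.* (suc k ℕ.* suc k)) (sym (ℕ.*-identityʳ (R ℕ.* R)))
      (isqrt-lower (n ℕ.* (suc k ℕ.* suc k)))))
  where R = isqrt (n ℕ.* (suc k ℕ.* suc k))

0≤log : ∀ n k → 0ℚ ℚ.≤ log-approximation n k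
0≤log n k = subst (ℚ._≤ log-approximation n k) (cong (λ t → + t / 1) (ℕ.*-zeroʳ l))
  (Σ-mono-lower l 0 0 _ (λ i _ → ℚ.<⇒≤ (/-pos (suc k ℕ.+ i))))
  where l = (n ℕ.∸ 1) ℕ.* suc k

-- After multiplication by α (2s - α) and with N = s², the difference of the two sides is
-- 2 s² (α - 1)² + (2/5) s² + (4/5) s α + 2 (s - 1) α².
4s-1≤ : ∀ {s α N} → 1ℚ ℚ.≤ s → 0ℚ ℚ.< α → 0ℚ ℚ.< + 2 / 1 ℚ.* s ℚ.- α → s ℚ.* s ℚ.≤ N →
        + 4 / 1 ℚ.* s ℚ.- 1ℚ ℚ.≤
        + 2 / 1 ℚ.* (1ℚ ℚ.+ + 6 / 10 ℚ.* recip α) ℚ.* s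
        ℚ.+ (+ 2 / 1 ℚ.* N ℚ.- 1ℚ) ℚ.* α ℚ.* recip (+ 2 / 1 ℚ.* s ℚ.- α)
4s-1≤ {s} {α} {N} 1≤s 0<α 0<d s²≤N = begin
  + 4 / 1 ℚ.* s ℚ.- 1ℚ
    ≤⟨ p≤p+q (0≤* (0≤* 0≤w 0≤z) 0≤Q) ⟩
  (+ 4 / 1 ℚ.* s ℚ.- 1ℚ) ℚ.+ w ℚ.* z ℚ.* Q
    ≡⟨ solve 4 (λ s α w z →
         con (+ 4 / 1) :* s :- con 1ℚ
         :+ w :* z :* (con (+ 2 / 1) :* (s :* s) :* ((α :- con 1ℚ) :* (α :- con 1ℚ))
                       :+ con (+ 4 / 10) :* (s :* s) :+ con (+ 8 / 10) :* (s :* α)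
                       :+ con (+ 2 / 1) :* (s :- con 1ℚ) :* (α :* α))
         := con (+ 4 / 1) :* s :- con 1ℚ
            :+ ((con 1ℚ :- con (+ 2 / 1) :* s) :* ((α :* w) :* ((con (+ 2 / 1) :* s :- α) :* z))
                :+ con (+ 12 / 10) :* (w :* s) :* ((con (+ 2 / 1) :* s :- α) :* z)
                :+ (con (+ 2 / 1) :* (s :* s) :- con 1ℚ) :* α :* z :* (α :* w)))
         refl s α w z ⟩
  F (α ℚ.* w) (d ℚ.* z)
    ≡⟨ cong₂ F (recip-inverse 0<α) (recip-inverse 0<d) ⟩
  F 1ℚ 1ℚ
    ≡⟨ solve 4 (λ s α w z →
         con (+ 4 / 1) :* s :- con 1ℚ
         :+ ((con 1ℚ :- con (+ 2 / 1) :* s) :* (con 1ℚ :* con 1ℚ)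
             :+ con (+ 12 / 10) :* (w :* s) :* con 1ℚ
             :+ (con (+ 2 / 1) :* (s :* s) :- con 1ℚ) :* α :* z :* con 1ℚ)
         := con (+ 2 / 1) :* (con 1ℚ :+ con (+ 6 / 10) :* w) :* s
            :+ (con (+ 2 / 1) :* (s :* s) :- con 1ℚ) :* α :* z)
         refl s α w z ⟩
  + 2 / 1 ℚ.* (1ℚ ℚ.+ + 6 / 10 ℚ.* w) ℚ.* s ℚ.+ (+ 2 / 1 ℚ.* (s ℚ.* s) ℚ.- 1ℚ) ℚ.* α ℚ.* z
    ≤⟨ ℚ.+-monoʳ-≤ (+ 2 / 1 ℚ.* (1ℚ ℚ.+ + 6 / 10 ℚ.* w) ℚ.* s)
         (ℚ.*-monoʳ-≤-nonNeg z {{ℚ.nonNegative 0≤z}}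
           (ℚ.*-monoʳ-≤-nonNeg α {{ℚ.nonNegative (ℚ.<⇒≤ 0<α)}}
             (ℚ.+-monoˡ-≤ (ℚ.- 1ℚ) (ℚ.*-monoˡ-≤-nonNeg (+ 2 / 1) s²≤N)))) ⟩
  + 2 / 1 ℚ.* (1ℚ ℚ.+ + 6 / 10 ℚ.* w) ℚ.* s ℚ.+ (+ 2 / 1 ℚ.* N ℚ.- 1ℚ) ℚ.* α ℚ.* z ∎
  where
  open ℚ.≤-Reasoning
  d = + 2 / 1 ℚ.* s ℚ.- α
  w = recip α
  z = recip d
  -- The ring solver knows nothing of reciprocals. The products αw and dz are therefore kept as the
  -- arguments of `F` in a polynomial identity, and then replaced by 1.
  F : ℚ → ℚ → ℚ
  F A B = (+ 4 / 1 ℚ.* s ℚ.- 1ℚ)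
    ℚ.+ ((1ℚ ℚ.- + 2 / 1 ℚ.* s) ℚ.* (A ℚ.* B) ℚ.+ + 12 / 10 ℚ.* (w ℚ.* s) ℚ.* B
         ℚ.+ (+ 2 / 1 ℚ.* (s ℚ.* s) ℚ.- 1ℚ) ℚ.* α ℚ.* z ℚ.* A)
  Q : ℚ
  Q = + 2 / 1 ℚ.* (s ℚ.* s) ℚ.* ((α ℚ.- 1ℚ) ℚ.* (α ℚ.- 1ℚ))
      ℚ.+ + 4 / 10 ℚ.* (s ℚ.* s) ℚ.+ + 8 / 10 ℚ.* (s ℚ.* α)
      ℚ.+ + 2 / 1 ℚ.* (s ℚ.- 1ℚ) ℚ.* (α ℚ.* α)
  0≤w = ℚ.<⇒≤ (recip-pos 0<α)
  0≤z = ℚ.<⇒≤ (recip-pos 0<d)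
  0≤2 = ℚ.nonNegative⁻¹ (+ 2 / 1)
  0≤s = ℚ.≤-trans (ℚ.nonNegative⁻¹ 1ℚ) 1≤s
  0≤Q : 0ℚ ℚ.≤ Q
  0≤Q = 0≤+ (0≤+ (0≤+ (0≤* (0≤* 0≤2 (0≤p² s)) (0≤p² (α ℚ.- 1ℚ)))
                      (0≤* (ℚ.nonNegative⁻¹ (+ 4 / 10)) (0≤p² s)))
                 (0≤* (ℚ.nonNegative⁻¹ (+ 8 / 10)) (0≤* 0≤s (ℚ.<⇒≤ 0<α))))
            (0≤* (0≤* 0≤2 (p≤q⇒0≤q-p 1≤s)) (0≤p² α))

-- From ρ ≤ 4r - 2 and r ≤ s; the spare 1 on the left becomes the gap that the strict inequality of
-- reals requires.
ρ+1≤4s-1 : ∀ {a b} → 0 ℕ.< a → 0 ℕ.< b → ∀ k →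
           + ρ a b / 1 ℚ.+ 1ℚ ℚ.≤ + 4 / 1 ℚ.* √-approximation (a ℕ.* b) k ℚ.- 1ℚ
ρ+1≤4s-1 {a} {b} 0<a 0<b k = begin
  + ρ a b / 1 ℚ.+ 1ℚ
    ≡⟨ solve 1 (λ p → p :+ con 1ℚ := p :+ con (+ 2 / 1) :- con 1ℚ) refl (+ ρ a b / 1) ⟩
  + ρ a b / 1 ℚ.+ + 2 / 1 ℚ.- 1ℚ
    ≡⟨ cong (ℚ._- 1ℚ) (/-+ (ρ a b) 2 0) ⟩
  + (ρ a b ℕ.+ 2) / 1 ℚ.- 1ℚ
    ≤⟨ ℚ.+-monoˡ-≤ (ℚ.- 1ℚ) (/-≤ (ρ a b ℕ.+ 2) 0 (4 ℕ.* r) 0 (ℕ.*-monoˡ-≤ 1 (ρ+2≤4√n 0<a 0<b))) ⟩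
  + (4 ℕ.* r) / 1 ℚ.- 1ℚ
    ≡⟨ cong (ℚ._- 1ℚ) (/-* 4 r 0 0) ⟨
  + 4 / 1 ℚ.* (+ r / 1) ℚ.- 1ℚ
    ≤⟨ ℚ.+-monoˡ-≤ (ℚ.- 1ℚ) (ℚ.*-monoˡ-≤-nonNeg (+ 4 / 1) (isqrt≤√ (a ℕ.* b) k)) ⟩
  + 4 / 1 ℚ.* √-approximation (a ℕ.* b) k ℚ.- 1ℚ ∎
  where
  open ℚ.≤-Reasoning
  r = isqrt (a ℕ.* b)

-- From the approximations to real numbers

0<⇒eventually : ∀ {x} (0<x : fromℕ 0 < x) i → _<_.from 0<x ℕ.≤ i → 0ℚ ℚ.< seq x i
0<⇒eventually {x} (mk< gap 0<gap _ holds) i h =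
  ℚ.<-≤-trans 0<gap (subst (ℚ._≤ seq x i) (ℚ.+-identityˡ gap) (holds i h))

theorem1 : (a b n : ℕ) → 0 ℕ.< a → 0 ℕ.< b → a ℕ.* b ≡ n → (1<n : 1 ℕ.< n) →
    (α : ℝ) (1≤α : fromℕ 1 ≤ α) (α≤√n : α ≤ √ n) →
    fromℕ (ρ a b) <
    (fromℕ 1 ÷ α [ 1≤⇒0< 1≤α ]) * √ n * log n
    + fromℕ 2 * (fromℕ 1 + fromℚ (+ 6 / 10) ÷ α [ 1≤⇒0< 1≤α ]) * √ n
    + ((fromℕ 2 * fromℕ n - fromℕ 1) * α) ÷ (fromℕ 2 * √ n - α) [ 0<2√n-x 1<n α≤√n ]
theorem1 a b n 0<a 0<b refl 1<n α 1≤α α≤√n =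
  -- From this index on, the terms of α and of 2 √ n - α are positive, so `recip` is a true inverse
  -- at both. The inequality is then checked term by term.
  mk< 1ℚ (ℚ.positive⁻¹ 1ℚ) (_<_.from 0<α ℕ.⊔ _<_.from 0<d) λ i hi →
  let s  = √-approximation n i
      A  = 1ℚ ℚ.* recip (seq α i) ℚ.* s ℚ.* log-approximation n i
      B  = + 2 / 1 ℚ.* (1ℚ ℚ.+ + 6 / 10 ℚ.* recip (seq α i)) ℚ.* s
      C  = (+ 2 / 1 ℚ.* (+ n / 1) ℚ.- 1ℚ) ℚ.* seq α i ℚ.* recip (+ 2 / 1 ℚ.* s ℚ.- seq α i)
      0<αᵢ = 0<⇒eventually 0<α i (ℕ.m⊔n≤o⇒m≤o (_<_.from 0<α) (_<_.from 0<d) hi)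
      0<dᵢ = 0<⇒eventually 0<d i (ℕ.m⊔n≤o⇒n≤o (_<_.from 0<α) (_<_.from 0<d) hi)
      1≤s  = 1≤√-approximation 1<n i
      0≤A  = 0≤* (0≤* (0≤* (ℚ.nonNegative⁻¹ 1ℚ) (ℚ.<⇒≤ (recip-pos 0<αᵢ)))
                      (ℚ.≤-trans (ℚ.nonNegative⁻¹ 1ℚ) 1≤s))
                 (0≤log n i)
  in begin
    + ρ a b / 1 ℚ.+ 1ℚ       ≤⟨ ρ+1≤4s-1 0<a 0<b i ⟩
    + 4 / 1 ℚ.* s ℚ.- 1ℚ     ≤⟨ 4s-1≤ 1≤s 0<αᵢ 0<dᵢ (√²≤ n i) ⟩
    B ℚ.+ C                  ≤⟨ p≤p+q 0≤A ⟩
    B ℚ.+ C ℚ.+ A            ≡⟨ solve 3 (λ A B C → B :+ C :+ A := A :+ B :+ C) refl A B C ⟩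
    A ℚ.+ B ℚ.+ C            ∎
  where
  open ℚ.≤-Reasoning
  0<α = 1≤⇒0< 1≤α
  0<d = 0<2√n-x 1<n α≤√n
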